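{- Any (possibly randomized) two-party communication protocol that solves the $(2\Delta-1)$-edge coloring problem requires $\Omega(n)$ bits of communication in expectation, where $n$ is the number of vertices of the input graph.
   Context: Two-party edge-partition model: $G=(V,E)$ is a finite simple undirected graph with $n$ vertices and maximum degree $\Delta$. The vertex set $V$ and the numbers $n,\Delta$ are known to both parties. The edge set is partitioned adversarially as $E=E_A\sqcup E_B$; Alice receives $E_A$, Bob receives $E_B$. The parties may use public and private randomness. Communication is the total number of bits exchanged. A $(2\Delta-1)$-edge coloring is an assignment of colors from a fixed set of $2\Delta-1$ colors to the edges such that any two edges sharing an endpoint receive different colors. Alice must output the colors of $E_A$ and Bob those of $E_B$. A protocol solves the problem if on every input the combined output is always a proper edge coloring (Las Vegas). Its expected communication for $n$-vertex inputs is the maximum, over all inputs (graph and edge partition) on $n$ vertices, of the expected number of bits exchanged, the expectation being over the protocol's randomness. -}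

module Defs where

open import Data.Bool using (Bool; true; false; T; _∧_; _∨_; if_then_else_)
open import Data.Fin using (Fin)
open import Data.Integer using (+_)
open import Data.List using (List; []; _∷_; length; map; filterᵇ; allFin)
open import Data.List.Extrema.Nat using (max)
open import Data.Nat as ℕ using (ℕ; zero; suc; _∸_)
open import Data.Product using (Σ-syntax; ∃-syntax; _×_)
open import Data.Rational using (ℚ; 0ℚ; 1ℚ; ½; _+_; _-_; _*_; _≤_; _<_; _/_)
open import Relation.Binary.Construct.Closure.ReflexiveTransitive using (Star)
open import Relation.Binary.PropositionalEquality using (_≡_; _≢_; refl; cong₂)

record SimpleGraph (n : ℕ) : Set where
  field
    adj        : Fin n → Fin n → Bool
    adj-sym    : ∀ u v → adj u v ≡ adj v u
    adj-irrefl : ∀ u → adj u u ≡ false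

open SimpleGraph public

infixr 6 _∪_

_∪_ : ∀ {n} → SimpleGraph n → SimpleGraph n → SimpleGraph n
adj        (G ∪ H) u v = adj G u v ∨ adj H u v
adj-sym    (G ∪ H) u v = cong₂ _∨_ (adj-sym G u v) (adj-sym H u v)
adj-irrefl (G ∪ H) u   = cong₂ _∨_ (adj-irrefl G u) (adj-irrefl H u)

degree : ∀ {n} → SimpleGraph n → Fin n → ℕ
degree {n} G u = length (filterᵇ (adj G u) (allFin n))

maxDegree : ∀ {n} → SimpleGraph n → ℕ
maxDegree {n} G = max 0 (map (degree G) (allFin n))

-- A graph on the vertex set Fin n of maximum degree Δ together with a
-- partition of its edges; the graph itself is edgesA ∪ edgesB.
record Input (n Δ : ℕ) : Set where
  field
    edgesA edgesB : SimpleGraph n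
    disjoint      : ∀ u v → adj edgesA u v ∧ adj edgesB u v ≡ false
    max-degree    : maxDegree (edgesA ∪ edgesB) ≡ Δ

open Input public

-- Values off the edges are irrelevant. Colors are natural numbers, confined to
-- {0, …, k - 1} by IsProperEdgeColoring, rather than elements of Fin k: with
-- Δ = 0 the palette is empty, and a Fin 0-valued function on pairs of vertices
-- could not be output even though there is nothing to color.
Coloring : ℕ → Set
Coloring n = Fin n → Fin n → ℕ

record IsProperEdgeColoring {n} (G : SimpleGraph n) (k : ℕ) (c : Coloring n) : Set where
  field
    symmetric  : ∀ {u v} → T (adj G u v) → c u v ≡ c v u
    in-palette : ∀ {u v} → T (adj G u v) → c u v ℕ.< k
    proper     : ∀ {u v w} → T (adj G u v) → T (adj G u w) → v ≢ w → c u v ≢ c u w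

-- Alice's colors on Alice's edges, Bob's elsewhere.
combine : ∀ {n Δ} → Input n Δ → Coloring n → Coloring n → Coloring n
combine I cA cB u v = if adj (edgesA I) u v then cA u v else cB u v

-- What both parties have seen: the public coins and the bits exchanged so far,
-- most recent first. The turn function of a protocol determines which entries
-- are coins and which were sent by whom.
History : Set
History = List Bool

-- The private coins a party has tossed so far, most recent first.
Coins : Set
Coins = List Bool

data Turn : Set where
  publicCoin alice bob over : Turn

-- A party asked for a value may first toss any number of further private coins,
-- which lets it sample from non-dyadic distributions.
data Action (X : Set) : Set where
  toss   : Action X
  commit : X → Action X

-- Whose turn it is depends on public information only; everything else a party
-- does depends on its own edges, its own coins and the public information.
-- There is no bound on the length of a run.
record Protocol (n Δ : ℕ) : Set where
  field
    turn        : History → Turn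
    sendA sendB : SimpleGraph n → Coins → History → Action Bool
    outA  outB  : SimpleGraph n → Coins → History → Action (Coloring n)

record Config : Set where
  constructor ⟨_,_,_⟩
  field
    history       : History
    coinsA coinsB : Coins

start : Config
start = ⟨ [] , [] , [] ⟩

data Step (n : ℕ) : Set where
  coin : (Bool → Config) → Step n              -- toss a fair coin
  send : Config → Step n                       -- exchange one bit
  halt : (cA cB : Coloring n) → Step n

module Run {n Δ : ℕ} (P : Protocol n Δ) (I : Input n Δ) where
  open Protocol P

  tossA tossB : Config → Step n
  tossA ⟨ h , a , b ⟩ = coin λ x → ⟨ h , x ∷ a , b ⟩
  tossB ⟨ h , a , b ⟩ = coin λ x → ⟨ h , a , x ∷ b ⟩

  message : Config → Bool → Step n
  message ⟨ h , a , b ⟩ m = send ⟨ m ∷ h , a , b ⟩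

  step : Config → Step n
  step s@(⟨ h , a , b ⟩) with turn h
  ... | publicCoin = coin λ x → ⟨ x ∷ h , a , b ⟩
  ... | alice with sendA (edgesA I) a h
  ...   | toss     = tossA s
  ...   | commit m = message s m
  step s@(⟨ h , a , b ⟩) | bob with sendB (edgesB I) b h
  ...   | toss     = tossB s
  ...   | commit m = message s m
  step s@(⟨ h , a , b ⟩) | over with outA (edgesA I) a h | outB (edgesB I) b h
  ...   | toss      | _         = tossA s
  ...   | commit _  | toss      = tossB s
  ...   | commit cA | commit cB = halt cA cB

  data _⟶_ (s : Config) : Config → Set where
    by-coin : ∀ {k} → step s ≡ coin k → ∀ x → s ⟶ k x
    by-send : ∀ {s′} → step s ≡ send s′ → s ⟶ s′

  Reachable : Config → Set
  Reachable = Star _⟶_ start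

  -- The probability that a run from s has halted within t steps.
  haltProb : ℕ → Config → ℚ
  haltProb zero    s = 0ℚ
  haltProb (suc t) s with step s
  ... | coin k   = ½ * (haltProb t (k false) + haltProb t (k true))
  ... | send s′  = haltProb t s′
  ... | halt _ _ = 1ℚ

  -- The expected number of bits exchanged in the first t steps of a run from s.
  expectedBits : ℕ → Config → ℚ
  expectedBits zero    s = 0ℚ
  expectedBits (suc t) s with step s
  ... | coin k   = ½ * (expectedBits t (k false) + expectedBits t (k true))
  ... | send s′  = 1ℚ + expectedBits t s′
  ... | halt _ _ = 0ℚ

  -- Halting with probability 1.
  HaltsAlmostSurely : Set
  HaltsAlmostSurely = ∀ ε → 0ℚ < ε → ∃[ t ] 1ℚ - ε ≤ haltProb t start

  -- Every reachable configuration has positive probability, so no output,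
  -- however unlikely, may be wrong.
  AlwaysCorrect : Set
  AlwaysCorrect = ∀ {s cA cB} → Reachable s → step s ≡ halt cA cB →
    IsProperEdgeColoring (edgesA I ∪ edgesB I) (2 ℕ.* Δ ∸ 1) (combine I cA cB)

-- n and Δ are known to both parties.
ProtocolFamily : Set
ProtocolFamily = ∀ n Δ → Protocol n Δ

SolvesEdgeColoring : ProtocolFamily → Set
SolvesEdgeColoring P = ∀ n Δ (I : Input n Δ) →
  Run.HaltsAlmostSurely (P n Δ) I × Run.AlwaysCorrect (P n Δ) I

-- q is at most the supremum, possibly infinite, of f.
_≤sup_ : ℚ → (ℕ → ℚ) → Set
q ≤sup f = ∀ r → r < q → ∃[ t ] r < f t

-- By monotone convergence the expected number of bits exchanged in a whole run
-- is the supremum over t of the expected number exchanged in the first t steps.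
-- There are finitely many inputs on n vertices, so the maximum of the
-- expectations over all of them is at least q when one of them is.
ExpectedCommunication≥ : ProtocolFamily → ℕ → ℚ → Set
ExpectedCommunication≥ P n q = ∃[ Δ ] Σ[ I ∈ Input n Δ ]
  q ≤sup (λ t → Run.expectedBits (P n Δ) I t start)

fromℕ : ℕ → ℚ
fromℕ n = + n / 1

{-# OPTIONS --safe #-}

-- A direct sum argument with Δ = 2. A gadget has eight vertices: four shared ones, at which each
-- party has one edge, and two further ones per party. Each party chooses one of three edge sets in
-- the gadget, and if both outputs depend on the own choice only, then at each shared vertex one
-- party's color must be constant (three colors, disjoint ranges), which the edge sets exclude. So
-- in m independent gadgets, a rectangle of inputs on which the parties never communicate has for
-- each gadget a choice that one of them avoids, and contains at most 6^m of the 9^m pairs. A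
-- protocol that exchanges fewer than L bits splits the inputs into at most 2^L such rectangles;
-- randomization is handled by carrying the parties' coin sequences along in the rectangles, which
-- turns this count into
--   L · Pr[halted by time t] ≤ E[bits sent by time t] + 2^L · (6/9)^m
-- for uniformly random inputs, and m = 2 L makes the error term at most 1.
module Submission where

open import Defs
open import Data.Bool using (Bool; true; false; T; T?; not; _∧_; _∨_; if_then_else_)
open import Data.Bool.ListAction using (any)
import Data.Bool.Properties as Bool
open import Data.Empty using (⊥)
open import Data.Fin as Fin using (Fin; zero; suc; toℕ; fromℕ<; splitAt; _↑ˡ_; _↑ʳ_)
open import Data.Fin.Patterns
import Data.Fin.Properties as Fin
import Data.Integer as ℤ
import Data.Integer.Properties as ℤ
open import Data.List using (List; []; _∷_; _++_; length; map; concatMap; filterᵇ; allFin; tabulate)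
open import Data.List.Extrema.Nat using (max≤v⁺; v≤max⁺)
open import Data.List.Membership.Propositional using (_∈_; lose; find)
open import Data.List.Membership.Propositional.Properties using (∈-concatMap⁺; ∈-map⁺; ∈-allFin)
import Data.List.Properties as List
open import Data.List.Relation.Unary.All as All using (All; []; _∷_)
import Data.List.Relation.Unary.All.Properties as All
open import Data.List.Relation.Unary.Any as Any using (Any; here)
import Data.List.Relation.Unary.Any.Properties as Any
open import Data.Nat as ℕ using (ℕ; zero; suc; z≤n; s≤s)
import Data.Nat.DivMod as ℕ
open import Data.Nat.ListAction using (sum)
import Data.Nat.Properties as ℕ
open import Data.Nat.Tactic.RingSolver using (solve-∀)
open import Data.Product using (∃-syntax; _×_; _,_; proj₁; proj₂)
import Data.Rational as ℚ
import Data.Rational.Properties as ℚ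
import Data.Rational.Unnormalised as ℚᵘ
import Data.Rational.Unnormalised.Properties as ℚᵘ
open import Data.Sum as Sum using (_⊎_; inj₁; inj₂)
open import Data.Unit using (tt)
open import Data.Vec using (Vec; []; _∷_; lookup)
open import Function using (_∘_; id)
open import Relation.Binary.Construct.Closure.ReflexiveTransitive using (ε; _◅_; _◅◅_)
open import Relation.Binary.PropositionalEquality
open import Relation.Nullary using (Dec; yes; no; ¬_; ¬?; contradiction; _×-dec_; _→-dec_)
open import Relation.Nullary.Decidable using (toWitness; decidable-stable)

-- No bound on the number of coins of a run is given, so the randomness cannot be fixed in advance
-- as a finite seed. Runs are therefore cut off after `t` steps and weighed by how many of the
-- `2 ^ t` coin sequences extend them, which keeps the counting in `ℕ`. The induction fixes a public
-- history and keeps, for each input of a party, the list of private coin strings under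
-- consideration there. What a party does depends on its own input and string only, so a message
-- refines just one of the two families and the rectangle shape survives. Public coins lie in the
-- history and average two such states instead of multiplying the error. Zero error closes the
-- argument: in a halted rectangle every pair of strings is reachable and must give a proper
-- coloring, however small its weight. One string per input can thus be picked, and the outputs form
-- a deterministic coloring without communication, to which the gadget obstruction applies.

private variable
  X Y Z : Set

-- Finite sums and truncated powers of two

∑ : List X → (X → ℕ) → ℕ
∑ xs f = sum (map f xs)

module _ where
  open import Data.Nat using (_+_; _*_; _≤_)

  ∑-mono : ∀ {f g : X → ℕ} {xs} → All (λ x → f x ≤ g x) xs → ∑ xs f ≤ ∑ xs g
  ∑-mono []       = z≤n
  ∑-mono (p ∷ ps) = ℕ.+-mono-≤ p (∑-mono ps)

  ∑-cong : ∀ {f g : X → ℕ} {xs} → All (λ x → f x ≡ g x) xs → ∑ xs f ≡ ∑ xs g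
  ∑-cong []       = refl
  ∑-cong (p ∷ ps) = cong₂ _+_ p (∑-cong ps)

  ∑-mono′ : ∀ {f g : X → ℕ} xs → (∀ x → f x ≤ g x) → ∑ xs f ≤ ∑ xs g
  ∑-mono′ xs f≤g = ∑-mono (All.universal f≤g xs)

  ∑-cong′ : ∀ {f g : X → ℕ} xs → (∀ x → f x ≡ g x) → ∑ xs f ≡ ∑ xs g
  ∑-cong′ xs f≡g = ∑-cong (All.universal f≡g xs)

  ∑-+ : ∀ (f g : X → ℕ) xs → ∑ xs (λ x → f x + g x) ≡ ∑ xs f + ∑ xs g
  ∑-+ f g []       = refl
  ∑-+ f g (x ∷ xs) rewrite ∑-+ f g xs = lemma (f x) (g x) (∑ xs f) (∑ xs g)
    where
    lemma : ∀ a b c d → a + b + (c + d) ≡ a + c + (b + d)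
    lemma = solve-∀

  ∑-*ˡ : ∀ c (f : X → ℕ) xs → ∑ xs (λ x → c * f x) ≡ c * ∑ xs f
  ∑-*ˡ c f []       = sym (ℕ.*-zeroʳ c)
  ∑-*ˡ c f (x ∷ xs) rewrite ∑-*ˡ c f xs = sym (ℕ.*-distribˡ-+ c (f x) (∑ xs f))

  ∑-*ʳ : ∀ c (f : X → ℕ) xs → ∑ xs (λ x → f x * c) ≡ ∑ xs f * c
  ∑-*ʳ c f []       = refl
  ∑-*ʳ c f (x ∷ xs) rewrite ∑-*ʳ c f xs = sym (ℕ.*-distribʳ-+ c (f x) (∑ xs f))

  ∑-0 : ∀ {f : X → ℕ} xs → (∀ x → f x ≡ 0) → ∑ xs f ≡ 0
  ∑-0 []       f≡0 = refl
  ∑-0 (x ∷ xs) f≡0 = cong₂ _+_ (f≡0 x) (∑-0 xs f≡0)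

  ∑-++ : ∀ (f : X → ℕ) xs ys → ∑ (xs ++ ys) f ≡ ∑ xs f + ∑ ys f
  ∑-++ f []       ys = refl
  ∑-++ f (x ∷ xs) ys rewrite ∑-++ f xs ys = sym (ℕ.+-assoc (f x) _ _)

  ∑-map : ∀ (g : X → Y) (f : Y → ℕ) xs → ∑ (map g xs) f ≡ ∑ xs (f ∘ g)
  ∑-map g f []       = refl
  ∑-map g f (x ∷ xs) = cong (f (g x) +_) (∑-map g f xs)

  ∑-concatMap : ∀ (g : X → List Y) (f : Y → ℕ) xs →
    ∑ (concatMap g xs) f ≡ ∑ xs (λ x → ∑ (g x) f)
  ∑-concatMap g f []       = refl
  ∑-concatMap g f (x ∷ xs) =
    trans (∑-++ f (g x) (concatMap g xs)) (cong (∑ (g x) f +_) (∑-concatMap g f xs))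

  ∑-filter-≤ : ∀ (p : X → Bool) (f : X → ℕ) xs → ∑ (filterᵇ p xs) f ≤ ∑ xs f
  ∑-filter-≤ p f []       = z≤n
  ∑-filter-≤ p f (x ∷ xs) with p x
  ... | true  = ℕ.+-monoʳ-≤ (f x) (∑-filter-≤ p f xs)
  ... | false = ℕ.≤-trans (∑-filter-≤ p f xs) (ℕ.m≤n+m _ (f x))

  ∑₂-* : ∀ (f : X → ℕ) (g : Y → ℕ) xs ys →
    ∑ xs (λ x → ∑ ys λ y → f x * g y) ≡ ∑ xs f * ∑ ys g
  ∑₂-* f g xs ys = trans (∑-cong′ xs λ x → ∑-*ˡ (f x) g ys) (∑-*ʳ (∑ ys g) f xs)

  indicator : Bool → ℕ
  indicator true  = 1
  indicator false = 0

  count : (X → Bool) → List X → ℕ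
  count p xs = ∑ xs (indicator ∘ p)

  -- 2 ^ (D - k), and 0 when k > D.
  pow : ℕ → ℕ → ℕ
  pow D       zero    = 2 ℕ.^ D
  pow zero    (suc k) = 0
  pow (suc D) (suc k) = pow D k

  -- Strict only at `k = D`, where the extensions of a string of full length exceed the time limit
  -- and get weight 0. This is why weights are only bounded, while the counts of halting runs and of
  -- bits split exactly.
  pow-split : ∀ D k → pow D (suc k) + pow D (suc k) ≤ pow D k
  pow-split zero    k       = z≤n
  pow-split (suc D) zero    = ℕ.≤-reflexive (cong (2 ℕ.^ D +_) (sym (ℕ.+-identityʳ _)))
  pow-split (suc D) (suc k) = pow-split D k

  pow-suc : ∀ D k → 2 * pow D k ≤ pow (suc D) k
  pow-suc D       zero    = ℕ.≤-refl
  pow-suc zero    (suc k) = z≤n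
  pow-suc (suc D) (suc k) = pow-suc D k

-- Private coin tosses as binary trees

-- The coin strings at which a party first commits: the leaves of its tree of private tosses.
module Frontier (act : Coins → Action Z) where
  open import Data.Nat using (_+_; _≤_)

  Committed : Coins → Set
  Committed a = ∃[ z ] act a ≡ commit z

  frontier : ℕ → Coins → List Coins
  frontier zero    a = []
  frontier (suc k) a with act a
  ... | toss     = frontier k (false ∷ a) ++ frontier k (true ∷ a)
  ... | commit _ = a ∷ []

  -- Cutting the tree when the fuel runs out loses nothing: a branch that is still tossing then has
  -- length at least `D`, where `f` vanishes.
  frontier-∑ : ∀ {D} (f : Coins → ℕ) →
    (∀ a → act a ≡ toss → f a ≡ f (false ∷ a) + f (true ∷ a)) →
    (∀ a → D ≤ length a → f a ≡ 0) →
    ∀ k a → D ≤ k + length a → f a ≡ ∑ (frontier k a) f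
  frontier-∑ f split late zero    a D≤ = late a D≤
  frontier-∑ {D} f split late (suc k) a D≤ with act a in eq
  ... | commit _ = sym (ℕ.+-identityʳ (f a))
  ... | toss     = trans (split a eq) (trans (cong₂ _+_ (ih false) (ih true))
                     (sym (∑-++ f (frontier k (false ∷ a)) _)))
    where
    ih : ∀ x → f (x ∷ a) ≡ ∑ (frontier k (x ∷ a)) f
    ih x = frontier-∑ f split late k (x ∷ a) (subst (D ≤_) (sym (ℕ.+-suc k _)) D≤)

  -- A Kraft inequality for the leaves of the tree: splits may lose weight, and branches cut off by
  -- the fuel are dropped.
  frontier-∑-≤ : (f : Coins → ℕ) → (∀ a → f (false ∷ a) + f (true ∷ a) ≤ f a) →
    ∀ k a → ∑ (frontier k a) f ≤ f a
  frontier-∑-≤ f split zero    a = z≤n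
  frontier-∑-≤ f split (suc k) a with act a
  ... | commit _ = ℕ.≤-reflexive (ℕ.+-identityʳ (f a))
  ... | toss     = ℕ.≤-trans (ℕ.≤-reflexive (∑-++ f (frontier k (false ∷ a)) _))
                     (ℕ.≤-trans (ℕ.+-mono-≤ (frontier-∑-≤ f split k _) (frontier-∑-≤ f split k _))
                       (split a))

  frontier-All : (Q : Coins → Set) → (∀ a → act a ≡ toss → Q a → ∀ x → Q (x ∷ a)) →
    ∀ k a → Q a → All (λ a′ → Q a′ × Committed a′) (frontier k a)
  frontier-All Q extend zero    a q = []
  frontier-All Q extend (suc k) a q with act a in eq
  ... | commit z = (q , z , eq) ∷ []
  ... | toss     = All.++⁺ (frontier-All Q extend k _ (extend a eq q false))
                           (frontier-All Q extend k _ (extend a eq q true))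

  expand : ℕ → List Coins → List Coins
  expand D = concatMap (frontier D)

  expand-∑ : ∀ D (f : Coins → ℕ) →
    (∀ a → act a ≡ toss → f a ≡ f (false ∷ a) + f (true ∷ a)) →
    (∀ a → D ≤ length a → f a ≡ 0) →
    ∀ as → ∑ as f ≡ ∑ (expand D as) f
  expand-∑ D f split late as =
    trans (∑-cong′ as λ a → frontier-∑ f split late D a (ℕ.m≤m+n D _))
          (sym (∑-concatMap (frontier D) f as))

  expand-∑-≤ : ∀ D (f : Coins → ℕ) → (∀ a → f (false ∷ a) + f (true ∷ a) ≤ f a) →
    ∀ as → ∑ (expand D as) f ≤ ∑ as f
  expand-∑-≤ D f split as =
    ℕ.≤-trans (ℕ.≤-reflexive (∑-concatMap (frontier D) f as))
              (∑-mono′ as (frontier-∑-≤ f split D))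

  expand-All : ∀ D (Q : Coins → Set) → (∀ a → act a ≡ toss → Q a → ∀ x → Q (x ∷ a)) →
    ∀ {as} → All Q as → All (λ a → Q a × Committed a) (expand D as)
  expand-All D Q extend {as} qs =
    All.concat⁺ (All.map⁺ (All.map (λ {a} → frontier-All Q extend D a) qs))

module Message (act : Coins → Action Bool) where
  open import Data.Nat using (_+_; _≤_)
  open Frontier act

  says : Bool → Coins → Bool
  says m a with act a
  ... | toss         = false
  ... | commit false = not m
  ... | commit true  = m

  says-commit : ∀ m a → T (says m a) → act a ≡ commit m
  says-commit m a _ with act a
  says-commit false a _ | commit false = refl
  says-commit true  a _ | commit true  = refl

  saying : Bool → ℕ → List Coins → List Coins
  saying m D as = filterᵇ (says m) (expand D as)

  saying-∑ : ∀ D (f : Coins → ℕ) →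
    (∀ a → act a ≡ toss → f a ≡ f (false ∷ a) + f (true ∷ a)) →
    (∀ a → D ≤ length a → f a ≡ 0) →
    ∀ as → ∑ as f ≡ ∑ (saying false D as) f + ∑ (saying true D as) f
  saying-∑ D f split late as = trans (expand-∑ D f split late as) (partition committed)
    where
    committed : All Committed (expand D as)
    -- The carried predicate is a dummy, `ℕ` being merely inhabited: only the `Committed` half of
    -- the result is kept.
    committed = All.map proj₂ (expand-All D (λ _ → ℕ) (λ _ _ k _ → k) (All.universal (λ _ → 0) as))
    lemma : ∀ a b c → a + (b + c) ≡ b + (a + c)
    lemma = solve-∀
    partition : ∀ {bs} → All Committed bs →
      ∑ bs f ≡ ∑ (filterᵇ (says false) bs) f + ∑ (filterᵇ (says true) bs) f
    partition [] = refl
    partition {b ∷ bs} ((m , eq) ∷ cs) with act b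
    partition {b ∷ bs} ((false , _) ∷ cs) | commit false =
      trans (cong (f b +_) (partition cs)) (sym (ℕ.+-assoc (f b) _ _))
    partition {b ∷ bs} ((true , _) ∷ cs) | commit true =
      trans (cong (f b +_) (partition cs))
        (lemma (f b) (∑ (filterᵇ (says false) bs) f) (∑ (filterᵇ (says true) bs) f))

  saying-∑-≤ : ∀ m D (f : Coins → ℕ) → (∀ a → f (false ∷ a) + f (true ∷ a) ≤ f a) →
    ∀ as → ∑ (saying m D as) f ≤ ∑ as f
  saying-∑-≤ m D f split as =
    ℕ.≤-trans (∑-filter-≤ (says m) f (expand D as)) (expand-∑-≤ D f split as)

  saying-All : ∀ m D (Q : Coins → Set) → (∀ a → act a ≡ toss → Q a → ∀ x → Q (x ∷ a)) →
    ∀ {as} → All Q as → All (λ a → Q a × act a ≡ commit m) (saying m D as)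
  saying-All m D Q extend {as} qs = All.zipWith (λ (q , s) → q , says-commit m _ s)
    ( All.filter⁺ (T? ∘ says m) (All.map proj₁ (expand-All D Q extend qs))
    , All.all-filter (T? ∘ says m) (expand D as))

-- Probabilities and expectations of truncated runs as natural numbers

module Counting {n Δ : ℕ} (P : Protocol n Δ) (I : Input n Δ) where
  open import Data.Nat using (_+_; _*_; _≤_; _^_)
  open Protocol P
  open Run P I

  -- haltProb and expectedBits scaled by the number 2 ^ t of coin sequences.
  haltCount bitCount : ℕ → Config → ℕ
  haltCount zero    s = 0
  haltCount (suc t) s with step s
  ... | coin k   = haltCount t (k false) + haltCount t (k true)
  ... | send s′  = 2 * haltCount t s′
  ... | halt _ _ = 2 ^ suc t
  bitCount zero    s = 0
  bitCount (suc t) s with step s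
  ... | coin k   = bitCount t (k false) + bitCount t (k true)
  ... | send s′  = 2 * (2 ^ t + bitCount t s′)
  ... | halt _ _ = 0

  haltCount-coin : ∀ {s k} → step s ≡ coin k → ∀ t →
    haltCount (suc t) s ≡ haltCount t (k false) + haltCount t (k true)
  haltCount-coin eq t rewrite eq = refl

  haltCount-send : ∀ {s s′} → step s ≡ send s′ → ∀ t → haltCount (suc t) s ≡ 2 * haltCount t s′
  haltCount-send eq t rewrite eq = refl

  bitCount-coin : ∀ {s k} → step s ≡ coin k → ∀ t →
    bitCount (suc t) s ≡ bitCount t (k false) + bitCount t (k true)
  bitCount-coin eq t rewrite eq = refl

  bitCount-send : ∀ {s s′} → step s ≡ send s′ → ∀ t →
    bitCount (suc t) s ≡ 2 * (2 ^ t + bitCount t s′)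
  bitCount-send eq t rewrite eq = refl

  haltCount-≤ : ∀ t s → haltCount t s ≤ 2 ^ t
  haltCount-≤ zero    s = z≤n
  haltCount-≤ (suc t) s with step s
  ... | coin k   = ℕ.+-mono-≤ (haltCount-≤ t (k false))
                     (ℕ.≤-trans (haltCount-≤ t (k true)) (ℕ.m≤m+n _ 0))
  ... | send s′  = ℕ.*-monoʳ-≤ 2 (haltCount-≤ t s′)
  ... | halt _ _ = ℕ.≤-refl

  module _ {h : History} where

    step-public : ∀ {a b} → turn h ≡ publicCoin →
      step ⟨ h , a , b ⟩ ≡ coin λ x → ⟨ x ∷ h , a , b ⟩
    step-public eq rewrite eq = refl

    step-sendA-toss : ∀ {a b} → turn h ≡ alice → sendA (edgesA I) a h ≡ toss →
      step ⟨ h , a , b ⟩ ≡ tossA ⟨ h , a , b ⟩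
    step-sendA-toss eq eq′ rewrite eq | eq′ = refl

    step-sendA : ∀ {a b m} → turn h ≡ alice → sendA (edgesA I) a h ≡ commit m →
      step ⟨ h , a , b ⟩ ≡ send ⟨ m ∷ h , a , b ⟩
    step-sendA eq eq′ rewrite eq | eq′ = refl

    step-sendB-toss : ∀ {a b} → turn h ≡ bob → sendB (edgesB I) b h ≡ toss →
      step ⟨ h , a , b ⟩ ≡ tossB ⟨ h , a , b ⟩
    step-sendB-toss eq eq′ rewrite eq | eq′ = refl

    step-sendB : ∀ {a b m} → turn h ≡ bob → sendB (edgesB I) b h ≡ commit m →
      step ⟨ h , a , b ⟩ ≡ send ⟨ m ∷ h , a , b ⟩
    step-sendB eq eq′ rewrite eq | eq′ = refl

    step-outA-toss : ∀ {a b} → turn h ≡ over → outA (edgesA I) a h ≡ toss →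
      step ⟨ h , a , b ⟩ ≡ tossA ⟨ h , a , b ⟩
    step-outA-toss eq eq′ rewrite eq | eq′ = refl

    step-outB-toss : ∀ {a b cA} → turn h ≡ over → outA (edgesA I) a h ≡ commit cA →
      outB (edgesB I) b h ≡ toss → step ⟨ h , a , b ⟩ ≡ tossB ⟨ h , a , b ⟩
    step-outB-toss eq eq′ eq″ rewrite eq | eq′ | eq″ = refl

    step-halt : ∀ {a b cA cB} → turn h ≡ over → outA (edgesA I) a h ≡ commit cA →
      outB (edgesB I) b h ≡ commit cB → step ⟨ h , a , b ⟩ ≡ halt cA cB
    step-halt eq eq′ eq″ rewrite eq | eq′ | eq″ = refl

  -- What `haltCount` and `bitCount` have in common; it suffices to redistribute either of them over
  -- further coin tosses.
  record Additive (f : ℕ → Config → ℕ) : Set where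
    field
      at-zero : ∀ s → f 0 s ≡ 0
      at-coin : ∀ {s k} → step s ≡ coin k → ∀ t → f (suc t) s ≡ f t (k false) + f t (k true)

    -- The form for public coins, which lower the time limit `D` and leave the number `l` of private
    -- tosses alone.
    suc∸-coin : ∀ {s k} → step s ≡ coin k → ∀ D l →
      f (suc D ℕ.∸ l) s ≡ f (D ℕ.∸ l) (k false) + f (D ℕ.∸ l) (k true)
    suc∸-coin         eq D       zero    = at-coin eq D
    suc∸-coin {s} {k} eq zero    (suc l)
      rewrite ℕ.0∸n≡0 l | at-zero s | at-zero (k false) | at-zero (k true) = refl
    suc∸-coin         eq (suc D) (suc l) = suc∸-coin eq D l

    -- The form for private tosses, which raise `l` and leave `D` alone.
    ∸-coin : ∀ {s k} → step s ≡ coin k → ∀ D l →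
      f (D ℕ.∸ l) s ≡ f (D ℕ.∸ suc l) (k false) + f (D ℕ.∸ suc l) (k true)
    ∸-coin {s} {k} eq zero    l
      rewrite ℕ.0∸n≡0 l | at-zero s | at-zero (k false) | at-zero (k true) = refl
    ∸-coin         eq (suc D) l = suc∸-coin eq D l

    ∸-late : ∀ s {D l} → D ≤ l → f (D ℕ.∸ l) s ≡ 0
    ∸-late s D≤l rewrite ℕ.m≤n⇒m∸n≡0 D≤l = at-zero s

  open Additive public

  haltCount-additive : Additive haltCount
  haltCount-additive .at-zero s  = refl
  haltCount-additive .at-coin eq = haltCount-coin eq

  bitCount-additive : Additive bitCount
  bitCount-additive .at-zero s  = refl
  bitCount-additive .at-coin eq = bitCount-coin eq

  haltCount-∸-≤ : ∀ s D l → haltCount (D ℕ.∸ l) s ≤ pow D l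
  haltCount-∸-≤ s D       zero    = haltCount-≤ D s
  haltCount-∸-≤ s zero    (suc l) = z≤n
  haltCount-∸-≤ s (suc D) (suc l) = haltCount-∸-≤ s D l

  haltCount-∸-send : ∀ {s s′} → step s ≡ send s′ → ∀ D l →
    haltCount (suc D ℕ.∸ l) s ≡ 2 * haltCount (D ℕ.∸ l) s′
  haltCount-∸-send eq D       zero    = haltCount-send eq D
  haltCount-∸-send eq zero    (suc l) rewrite ℕ.0∸n≡0 l = refl
  haltCount-∸-send eq (suc D) (suc l) = haltCount-∸-send eq D l

  bitCount-∸-send : ∀ {s s′} → step s ≡ send s′ → ∀ D l →
    bitCount (suc D ℕ.∸ l) s ≡ 2 * (pow D l + bitCount (D ℕ.∸ l) s′)
  bitCount-∸-send eq D       zero    = bitCount-send eq D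
  bitCount-∸-send eq zero    (suc l) rewrite ℕ.0∸n≡0 l = refl
  bitCount-∸-send eq (suc D) (suc l) = bitCount-∸-send eq D l

-- A record, so that type checking compares graphs instead of unfolding maxDegree.
record HasMaxDegree {n} (G : SimpleGraph n) (d : ℕ) : Set where
  constructor hasMaxDegree
  field maxDegree≡ : maxDegree G ≡ d

partitionedInput : ∀ {n Δ} (G H : SimpleGraph n) → (∀ u v → adj G u v ∧ adj H u v ≡ false) →
  HasMaxDegree (G ∪ H) Δ → Input n Δ
partitionedInput G H G∩H d = record
  { edgesA = G ; edgesB = H ; disjoint = G∩H ; max-degree = HasMaxDegree.maxDegree≡ d }

-- Rectangles of inputs with coin strings, and the tradeoff between halting and communication

module Rectangles {n Δ : ℕ} (P : Protocol n Δ) {X Y : Set} (xs : List X) (ys : List Y)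
  (GA : X → SimpleGraph n) (GB : Y → SimpleGraph n)
  (GA∩GB : ∀ x y u v → adj (GA x) u v ∧ adj (GB y) u v ≡ false)
  (maxDeg : ∀ x y → HasMaxDegree (GA x ∪ GB y) Δ)
  where
  open import Data.Nat using (_+_; _*_; _≤_; _^_)
  open Protocol P

  input : X → Y → Input n Δ
  input x y = partitionedInput (GA x) (GB y) (GA∩GB x y) (maxDeg x y)

  module C x y = Counting P (input x y)
  module R x y = Run P (input x y)

  -- One side of a rectangle in the space of inputs paired with private coins. An input whose list
  -- is empty has left the rectangle.
  Strings : Set → Set
  Strings Z = Z → List Coins

  total : (X → Y → Coins → Coins → ℕ) → Strings X → Strings Y → ℕ
  total F A B = ∑ xs λ x → ∑ ys λ y → ∑ (A x) λ a → ∑ (B y) λ b → F x y a b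

  AllPairs : (X → Y → Coins → Coins → Set) → Strings X → Strings Y → Set
  AllPairs Q A B = ∀ x y → All (λ a → All (Q x y a) (B y)) (A x)

  total-mono : ∀ {F G A B} → AllPairs (λ x y a b → F x y a b ≤ G x y a b) A B →
    total F A B ≤ total G A B
  total-mono F≤G = ∑-mono′ xs λ x → ∑-mono′ ys λ y → ∑-mono (All.map ∑-mono (F≤G x y))

  total-cong : ∀ {F G A B} → AllPairs (λ x y a b → F x y a b ≡ G x y a b) A B →
    total F A B ≡ total G A B
  total-cong F≡G = ∑-cong′ xs λ x → ∑-cong′ ys λ y → ∑-cong (All.map ∑-cong (F≡G x y))

  total-+ : ∀ F G A B → total (λ x y a b → F x y a b + G x y a b) A B ≡ total F A B + total G A B
  total-+ F G A B =
    trans (∑-cong′ xs λ x → trans (∑-cong′ ys λ y → trans (∑-cong′ (A x) λ a → ∑-+ _ _ (B y))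
      (∑-+ _ _ (A x))) (∑-+ _ _ ys)) (∑-+ _ _ xs)

  total-*ˡ : ∀ c F A B → total (λ x y a b → c * F x y a b) A B ≡ c * total F A B
  total-*ˡ c F A B =
    trans (∑-cong′ xs λ x → trans (∑-cong′ ys λ y → trans (∑-cong′ (A x) λ a → ∑-*ˡ c _ (B y))
      (∑-*ˡ c _ (A x))) (∑-*ˡ c _ ys)) (∑-*ˡ c _ xs)

  -- A run within D steps in total, of which the parties have spent some on the tosses a and b.
  -- Public steps lower D instead, so private coins can be tossed in any order.
  within : ℕ → (X → Y → ℕ → Config → ℕ) → History → X → Y → Coins → Coins → ℕ
  within D f h x y a b = f x y (D ℕ.∸ (length a + length b)) ⟨ h , a , b ⟩

  weight : ℕ → X → Y → Coins → Coins → ℕ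
  weight D x y a b = pow D (length a + length b)

  halts bits : ℕ → History → Strings X → Strings Y → ℕ
  halts D h = total (within D C.haltCount h)
  bits  D h = total (within D C.bitCount h)

  weights : ℕ → Strings X → Strings Y → ℕ
  weights D = total (weight D)

  Reach : History → Strings X → Strings Y → Set
  Reach h = AllPairs λ x y a b → R.Reachable x y ⟨ h , a , b ⟩

  -- The Kraft inequality: no input pair has probability above 1. It serves as the invariant in
  -- place of prefix-freeness of the lists, from which it would follow.
  Bounded : ℕ → Strings X → Strings Y → Set
  Bounded D A B = ∀ x y → (∑ (A x) λ a → ∑ (B y) λ b → weight D x y a b) ≤ 2 ^ D

  halts-≤ : ∀ D h A B → halts D h A B ≤ weights D A B
  halts-≤ D h A B = total-mono {A = A} {B} λ x y →
    All.universal (λ a → All.universal (λ b → C.haltCount-∸-≤ x y _ D (length a + length b)) (B y)) (A x)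

  halts-zero : ∀ h A B → halts 0 h A B ≡ 0
  halts-zero h A B = ∑-0 xs λ x → ∑-0 ys λ y → ∑-0 (A x) λ a → ∑-0 (B y) λ b →
    cong (λ t → C.haltCount x y t ⟨ h , a , b ⟩) (ℕ.0∸n≡0 (length a + length b))

  -- Spending one step on a public coin or a message at least halves every weight, as well as the
  -- bound.
  Bounded-pred : ∀ {D A B} → Bounded (suc D) A B → Bounded D A B
  Bounded-pred {D} {A} {B} bounded x y = ℕ.*-cancelˡ-≤ 2 (begin
    2 * (∑ (A x) λ a → ∑ (B y) λ b → weight D x y a b)
      ≡⟨ ∑-*ˡ 2 _ (A x) ⟨
    (∑ (A x) λ a → 2 * ∑ (B y) λ b → weight D x y a b)
      ≡⟨ ∑-cong′ (A x) (λ a → ∑-*ˡ 2 _ (B y)) ⟨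
    (∑ (A x) λ a → ∑ (B y) λ b → 2 * weight D x y a b)
      ≤⟨ ∑-mono′ (A x) (λ a → ∑-mono′ (B y) λ b → pow-suc D (length a + length b)) ⟩
    (∑ (A x) λ a → ∑ (B y) λ b → weight (suc D) x y a b)
      ≤⟨ bounded x y ⟩
    2 ^ suc D ∎)
    where open ℕ.≤-Reasoning

  weight-tossB : ∀ D (a b : Coins) → pow D (length a + suc (length b)) + pow D (length a + suc (length b))
    ≤ pow D (length a + length b)
  weight-tossB D a b rewrite ℕ.+-suc (length a) (length b) = pow-split D (length a + length b)

  Valued : (X → Y → ℕ → Config → ℕ) → Set
  Valued f = ∀ x y → C.Additive x y (f x y)

  module _ {f} (val : Valued f) where

    within-late : ∀ {D h} x y a b → D ≤ length a + length b → within D f h x y a b ≡ 0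
    within-late x y a b = C.∸-late x y (val x y) _

    within-tossA : ∀ {D h} x y a b → R.step x y ⟨ h , a , b ⟩ ≡ R.tossA x y ⟨ h , a , b ⟩ →
      within D f h x y a b ≡ within D f h x y (false ∷ a) b + within D f h x y (true ∷ a) b
    within-tossA {D} x y a b eq = C.∸-coin x y (val x y) eq D (length a + length b)

    within-tossB : ∀ {D h} x y a b → R.step x y ⟨ h , a , b ⟩ ≡ R.tossB x y ⟨ h , a , b ⟩ →
      within D f h x y a b ≡ within D f h x y a (false ∷ b) + within D f h x y a (true ∷ b)
    within-tossB {D} x y a b eq rewrite ℕ.+-suc (length a) (length b) =
      C.∸-coin x y (val x y) eq D (length a + length b)

    total-public : ∀ {h} → turn h ≡ publicCoin → ∀ D A B →
      total (within (suc D) f h) A B ≡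
      total (within D f (false ∷ h)) A B + total (within D f (true ∷ h)) A B
    total-public eq D A B = trans
      (total-cong {A = A} {B} λ x y → All.universal (λ a → All.universal (λ b →
        C.suc∸-coin x y (val x y) (C.step-public x y eq) D (length a + length b)) (B y)) (A x))
      (total-+ _ _ A B)

  module AliceSpeaks {h} (eq : turn h ≡ alice) (D : ℕ) (A : Strings X) (B : Strings Y) where

    speech : X → Coins → Action Bool
    speech x a = sendA (GA x) a h

    -- Each string is prolonged until Alice commits and kept if she says `m`. This depends on `x`
    -- alone, so `B` stays as it is and the result is again a rectangle.
    A′ : Bool → Strings X
    A′ m x = Message.saying (speech x) m (suc D) (A x)

    total-split : ∀ {f} → Valued f → total (within (suc D) f h) A B ≡
      total (within (suc D) f h) (A′ false) B + total (within (suc D) f h) (A′ true) B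
    total-split val = trans (∑-cong′ xs λ x → trans (∑-cong′ ys λ y →
        Message.saying-∑ (speech x) (suc D) _
          (λ a eq′ → trans
            (∑-cong′ (B y) λ b → within-tossA val x y a b (C.step-sendA-toss x y eq eq′))
            (∑-+ _ _ (B y)))
          (λ a late → ∑-0 (B y) λ b →
            within-late val x y a b (ℕ.≤-trans late (ℕ.m≤m+n (length a) (length b))))
          (A x))
      (∑-+ _ _ ys)) (∑-+ _ _ xs)

    bounded′ : Bounded (suc D) A B → ∀ m → Bounded D (A′ m) B
    bounded′ bounded m = Bounded-pred {D} {A′ m} {B} λ x y → ℕ.≤-trans
      (Message.saying-∑-≤ (speech x) m (suc D) _ (λ a → ℕ.≤-trans
        (ℕ.≤-reflexive (sym (∑-+ _ _ (B y))))
        (∑-mono′ (B y) λ b → pow-split (suc D) (length a + length b))) (A x))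
      (bounded x y)

    steps : Reach h A B → ∀ m → AllPairs (λ x y a b →
      R.Reachable x y ⟨ h , a , b ⟩ × R.step x y ⟨ h , a , b ⟩ ≡ send ⟨ m ∷ h , a , b ⟩) (A′ m) B
    steps reach m x y = All.map
      (λ (rs , eq′) → All.map (λ r → r , C.step-sendA x y eq eq′) rs)
      (Message.saying-All (speech x) m (suc D) _
        (λ a eq′ rs x′ → All.map
          (λ r → r ◅◅ R.by-coin (C.step-sendA-toss x y eq eq′) x′ ◅ ε) rs)
        (reach x y))

  module BobSpeaks {h} (eq : turn h ≡ bob) (D : ℕ) (A : Strings X) (B : Strings Y) where

    speech : Y → Coins → Action Bool
    speech y b = sendB (GB y) b h

    B′ : Bool → Strings Y
    B′ m y = Message.saying (speech y) m (suc D) (B y)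

    total-split : ∀ {f} → Valued f → total (within (suc D) f h) A B ≡
      total (within (suc D) f h) A (B′ false) + total (within (suc D) f h) A (B′ true)
    total-split val = trans (∑-cong′ xs λ x → trans (∑-cong′ ys λ y → trans (∑-cong′ (A x) λ a →
        Message.saying-∑ (speech y) (suc D) _
          (λ b eq′ → within-tossB val x y a b (C.step-sendB-toss x y eq eq′))
          (λ b late →
            within-late val x y a b (ℕ.≤-trans late (ℕ.m≤n+m (length b) (length a))))
          (B y))
      (∑-+ _ _ (A x))) (∑-+ _ _ ys)) (∑-+ _ _ xs)

    bounded′ : Bounded (suc D) A B → ∀ m → Bounded D A (B′ m)
    bounded′ bounded m = Bounded-pred {D} {A} {B′ m} λ x y → ℕ.≤-trans
      (∑-mono′ (A x) λ a → Message.saying-∑-≤ (speech y) m (suc D) _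
        (weight-tossB (suc D) a) (B y))
      (bounded x y)

    steps : Reach h A B → ∀ m → AllPairs (λ x y a b →
      R.Reachable x y ⟨ h , a , b ⟩ × R.step x y ⟨ h , a , b ⟩ ≡ send ⟨ m ∷ h , a , b ⟩) A (B′ m)
    steps reach m x y = All.map
      (λ rs → All.map (λ (r , eq′) → r , C.step-sendB x y eq eq′)
        (Message.saying-All (speech y) m (suc D) _
          (λ b eq′ r x′ → r ◅◅ R.by-coin (C.step-sendB-toss x y eq eq′) x′ ◅ ε)
          rs))
      (reach x y)

  module Outputs {h} (eq : turn h ≡ over) (D : ℕ) (A : Strings X) (B : Strings Y) where

    verdictA : X → Coins → Action (Coloring n)
    verdictA x a = outA (GA x) a h

    verdictB : Y → Coins → Action (Coloring n)
    verdictB y b = outB (GB y) b h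

    A′ : Strings X
    A′ x = Frontier.expand (verdictA x) D (A x)

    B′ : Strings Y
    B′ y = Frontier.expand (verdictB y) D (B y)

    committedA : ∀ x → All (Frontier.Committed (verdictA x)) (A′ x)
    committedA x = All.map proj₂ (Frontier.expand-All (verdictA x) D (λ _ → ℕ) (λ _ _ k _ → k)
      (All.universal (λ _ → 0) (A x)))

    total-expand : ∀ {f} → Valued f → total (within D f h) A B ≡ total (within D f h) A′ B′
    total-expand val = ∑-cong′ xs λ x → ∑-cong′ ys λ y → trans
      (Frontier.expand-∑ (verdictA x) D _
          (λ a eq′ → trans
            (∑-cong′ (B y) λ b → within-tossA val x y a b (C.step-outA-toss x y eq eq′))
            (∑-+ _ _ (B y)))
          (λ a late → ∑-0 (B y) λ b →
            within-late val x y a b (ℕ.≤-trans late (ℕ.m≤m+n (length a) (length b))))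
          (A x))
      -- Bob tosses for his output only once Alice has committed hers, so his strings are expanded
      -- next to those of `A′`, not of `A`.
      (∑-cong (All.map (λ {a} (cA , eq′) → Frontier.expand-∑ (verdictB y) D _
          (λ b eq″ → within-tossB val x y a b (C.step-outB-toss x y eq eq′ eq″))
          (λ b late →
            within-late val x y a b (ℕ.≤-trans late (ℕ.m≤n+m (length b) (length a))))
          (B y)) (committedA x)))

    bounded′ : Bounded D A B → Bounded D A′ B′
    bounded′ bounded x y = ℕ.≤-trans (∑-mono′ (A′ x) λ a →
        Frontier.expand-∑-≤ (verdictB y) D _ (weight-tossB D a) (B y))
      (ℕ.≤-trans
        (Frontier.expand-∑-≤ (verdictA x) D _ (λ a → ℕ.≤-trans
          (ℕ.≤-reflexive (sym (∑-+ _ _ (B y))))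
          (∑-mono′ (B y) λ b → pow-split D (length a + length b))) (A x))
        (bounded x y))

    Halts : X → Y → Coins → Coins → Set
    Halts x y a b = ∃[ cA ] ∃[ cB ] (verdictA x a ≡ commit cA) × (verdictB y b ≡ commit cB) ×
      R.Reachable x y ⟨ h , a , b ⟩ × R.step x y ⟨ h , a , b ⟩ ≡ halt cA cB

    steps : Reach h A B → AllPairs Halts A′ B′
    steps reach x y = All.map
      (λ (rs , cA , eq′) → All.map
        (λ (r , cB , eq″) → cA , cB , eq′ , eq″ , r , C.step-halt x y eq eq′ eq″)
        (Frontier.expand-All (verdictB y) D _
          (λ b eq″ r x′ → r ◅◅ R.by-coin (C.step-outB-toss x y eq eq′ eq″) x′ ◅ ε)
          rs))
      (Frontier.expand-All (verdictA x) D _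
        (λ a eq′ rs x′ → All.map
          (λ r → r ◅◅ R.by-coin (C.step-outA-toss x y eq eq′) x′ ◅ ε) rs)
        (reach x y))

  nonempty : List Coins → Bool
  nonempty []      = false
  nonempty (_ ∷ _) = true

  -- Derandomizes a halted rectangle: any string in the list will do, since no reachable output may
  -- be wrong. The default colorings are never consulted where properness is claimed, as the lists
  -- are then nonempty and their strings committed.
  firstOutput : (Coins → Action (Coloring n)) → List Coins → Coloring n
  firstOutput verdict []      = λ _ _ → 0
  firstOutput verdict (a ∷ _) with verdict a
  ... | toss     = λ _ _ → 0
  ... | commit c = c

  -- Only pairs of inputs that are both still present contribute, each at most `2 ^ D`.
  weights-≤ : ∀ {D} A B → Bounded D A B →
    weights D A B ≤ count (nonempty ∘ A) xs * count (nonempty ∘ B) ys * 2 ^ D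
  weights-≤ {D} A B bounded = begin
    weights D A B
      ≤⟨ ∑-mono′ xs (λ x → ∑-mono′ ys (entry x)) ⟩
    (∑ xs λ x → ∑ ys λ y → indicator (nonempty (A x)) * indicator (nonempty (B y)) * 2 ^ D)
      ≡⟨ ∑-cong′ xs (λ x → ∑-*ʳ (2 ^ D) _ ys) ⟩
    (∑ xs λ x → (∑ ys λ y → indicator (nonempty (A x)) * indicator (nonempty (B y))) * 2 ^ D)
      ≡⟨ ∑-*ʳ (2 ^ D) _ xs ⟩
    (∑ xs λ x → ∑ ys λ y → indicator (nonempty (A x)) * indicator (nonempty (B y))) * 2 ^ D
      ≡⟨ cong (_* 2 ^ D) (∑₂-* (indicator ∘ nonempty ∘ A) (indicator ∘ nonempty ∘ B) xs ys) ⟩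
    count (nonempty ∘ A) xs * count (nonempty ∘ B) ys * 2 ^ D ∎
    where
    open ℕ.≤-Reasoning
    entry : ∀ x y → (∑ (A x) λ a → ∑ (B y) λ b → weight D x y a b) ≤
      indicator (nonempty (A x)) * indicator (nonempty (B y)) * 2 ^ D
    entry x y with A x | B y | bounded x y
    ... | []     | _     | _ = z≤n
    ... | a ∷ as | []    | _ = ℕ.≤-reflexive (∑-0 (a ∷ as) λ _ → refl)
    ... | _ ∷ _  | _ ∷ _ | w = ℕ.≤-trans w (ℕ.≤-reflexive (sym (ℕ.+-identityʳ _)))

  module _ (M : ℕ)
    (correct : ∀ x y → R.AlwaysCorrect x y)
    (silent : ∀ (p : X → Bool) (q : Y → Bool) (cA : X → Coloring n) (cB : Y → Coloring n) →
      (∀ x y → T (p x) → T (q y) →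
        IsProperEdgeColoring (GA x ∪ GB y) (2 * Δ ℕ.∸ 1) (combine (input x y) (cA x) (cB y))) →
      count p xs * count q ys ≤ M)
    where

    -- With the history fixed, each output is a function of the party's own input and string. The
    -- chosen outputs form a silent coloring on all surviving input pairs, so `silent` leaves at
    -- most `M` of them.
    halts-over : ∀ {h} → turn h ≡ over → ∀ D A B → Bounded D A B → Reach h A B →
      halts D h A B ≤ 2 ^ D * M
    halts-over {h} eq D A B bounded reach = begin
      halts D h A B                   ≡⟨ total-expand C.haltCount-additive ⟩
      halts D h A′ B′                 ≤⟨ halts-≤ D h A′ B′ ⟩
      weights D A′ B′                 ≤⟨ weights-≤ A′ B′ (bounded′ bounded) ⟩
      count (nonempty ∘ A′) xs * count (nonempty ∘ B′) ys * 2 ^ D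
        ≤⟨ ℕ.*-monoˡ-≤ (2 ^ D) (silent _ _ (λ x → firstOutput (verdictA x) (A′ x))
                                 (λ y → firstOutput (verdictB y) (B′ y)) proper-output) ⟩
      M * 2 ^ D                       ≡⟨ ℕ.*-comm M (2 ^ D) ⟩
      2 ^ D * M                       ∎
      where
      open ℕ.≤-Reasoning
      open Outputs eq D A B
      proper-output : ∀ x y → T (nonempty (A′ x)) → T (nonempty (B′ y)) →
        IsProperEdgeColoring (GA x ∪ GB y) (2 * Δ ℕ.∸ 1)
          (combine (input x y) (firstOutput (verdictA x) (A′ x)) (firstOutput (verdictB y) (B′ y)))
      proper-output x y _ _ with A′ x | B′ y | steps reach x y
      ... | _ ∷ _ | _ ∷ _ | ((_ , _ , eqA , eqB , r , s) ∷ _) ∷ _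
        rewrite eqA | eqB = correct x y r s

    -- The `W` are the weights entering the two branches. Each is charged one bit, and `H₀ ≤ W₀`,
    -- `H₁ ≤ W₁` let that bit pay for the extra unit in `suc L`. The error doubles twice: there are
    -- two rectangles, and the scale grows by one step.
    message-cost : ∀ L K {H B H₀ H₁ B₀ B₁ W₀ W₁} →
      H ≡ 2 * H₀ + 2 * H₁ → B ≡ 2 * (W₀ + B₀) + 2 * (W₁ + B₁) → H₀ ≤ W₀ → H₁ ≤ W₁ →
      L * H₀ ≤ B₀ + K → L * H₁ ≤ B₁ + K → suc L * H ≤ B + 2 * (2 * K)
    message-cost L K {H₀ = H₀} {H₁} {B₀} {B₁} {W₀} {W₁} refl refl h₀ h₁ i₀ i₁ = begin
      suc L * (2 * H₀ + 2 * H₁)                      ≡⟨ expandˡ L H₀ H₁ ⟩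
      2 * (H₀ + L * H₀) + 2 * (H₁ + L * H₁)
        ≤⟨ ℕ.+-mono-≤ (ℕ.*-monoʳ-≤ 2 (ℕ.+-mono-≤ h₀ i₀)) (ℕ.*-monoʳ-≤ 2 (ℕ.+-mono-≤ h₁ i₁)) ⟩
      2 * (W₀ + (B₀ + K)) + 2 * (W₁ + (B₁ + K))      ≡⟨ expandʳ B₀ B₁ W₀ W₁ K ⟩
      2 * (W₀ + B₀) + 2 * (W₁ + B₁) + 2 * (2 * K)    ∎
      where
      open ℕ.≤-Reasoning
      expandˡ : ∀ L a b → suc L * (2 * a + 2 * b) ≡ 2 * (a + L * a) + 2 * (b + L * b)
      expandˡ = solve-∀
      expandʳ : ∀ b₀ b₁ w₀ w₁ k →
        2 * (w₀ + (b₀ + k)) + 2 * (w₁ + (b₁ + k)) ≡ 2 * (w₀ + b₀) + 2 * (w₁ + b₁) + 2 * (2 * k)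
      expandʳ = solve-∀

    halts-send : ∀ {D h m A B} → AllPairs (λ x y a b → R.Reachable x y ⟨ h , a , b ⟩ ×
        R.step x y ⟨ h , a , b ⟩ ≡ send ⟨ m ∷ h , a , b ⟩) A B →
      halts (suc D) h A B ≡ 2 * halts D (m ∷ h) A B
    halts-send {D} {A = A} {B} st = trans
      (total-cong {A = A} {B} λ x y → All.map (λ {a} → All.map λ {b} (_ , eq) →
        C.haltCount-∸-send x y eq D (length a + length b)) (st x y))
      (total-*ˡ 2 _ A B)

    bits-send : ∀ {D h m A B} → AllPairs (λ x y a b → R.Reachable x y ⟨ h , a , b ⟩ ×
        R.step x y ⟨ h , a , b ⟩ ≡ send ⟨ m ∷ h , a , b ⟩) A B →
      bits (suc D) h A B ≡ 2 * (weights D A B + bits D (m ∷ h) A B)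
    bits-send {D} {A = A} {B} st = trans
      (total-cong {A = A} {B} λ x y → All.map (λ {a} → All.map λ {b} (_ , eq) →
        C.bitCount-∸-send x y eq D (length a + length b)) (st x y))
      (trans (total-*ˡ 2 _ A B) (cong (2 *_) (total-+ _ _ A B)))

    Reach-send : ∀ {h m A B} → AllPairs (λ x y a b → R.Reachable x y ⟨ h , a , b ⟩ ×
        R.step x y ⟨ h , a , b ⟩ ≡ send ⟨ m ∷ h , a , b ⟩) A B → Reach (m ∷ h) A B
    Reach-send st x y = All.map (All.map λ (r , eq) → r ◅◅ R.by-send eq ◅ ε) (st x y)

    -- `L` is a budget of bits: a run that exhausts it has paid for itself, and at `L = 0` nothing
    -- is claimed. A run that halts earlier does so in a silent rectangle, and each message at most
    -- doubles their number. Private tosses take no induction step, as they are absorbed into the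
    -- strings.
    tradeoff : ∀ D L h A B → Bounded D A B → Reach h A B →
      L * halts D h A B ≤ bits D h A B + 2 ^ L * (2 ^ D * M)
    tradeoff zero    L h A B bounded reach =
      ℕ.≤-trans (ℕ.≤-reflexive (trans (cong (L *_) (halts-zero h A B)) (ℕ.*-zeroʳ L))) z≤n
    tradeoff (suc D) L h A B bounded reach = go (turn h) refl L
      where
      double : ∀ k d m → 2 * (2 * (k * (d * m))) ≡ 2 * k * (2 * d * m)
      double = solve-∀

      go : ∀ t → turn h ≡ t → ∀ L →
        L * halts (suc D) h A B ≤ bits (suc D) h A B + 2 ^ L * (2 ^ suc D * M)
      go publicCoin eq L = begin
        L * halts (suc D) h A B
          ≡⟨ cong (L *_) (total-public C.haltCount-additive eq D A B) ⟩
        L * (halts D (false ∷ h) A B + halts D (true ∷ h) A B)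
          ≡⟨ ℕ.*-distribˡ-+ L _ _ ⟩
        L * halts D (false ∷ h) A B + L * halts D (true ∷ h) A B
          ≤⟨ ℕ.+-mono-≤ (ih false) (ih true) ⟩
        (bits D (false ∷ h) A B + 2 ^ L * (2 ^ D * M)) + (bits D (true ∷ h) A B + 2 ^ L * (2 ^ D * M))
          -- The two outcomes share the `2 ^ suc D` sequences, so a public coin leaves the relative
          -- error unchanged.
          ≡⟨ regroup (bits D (false ∷ h) A B) (bits D (true ∷ h) A B) (2 ^ L) (2 ^ D) M ⟩
        bits D (false ∷ h) A B + bits D (true ∷ h) A B + 2 ^ L * (2 ^ suc D * M)
          ≡⟨ cong (_+ 2 ^ L * (2 ^ suc D * M)) (total-public C.bitCount-additive eq D A B) ⟨
        bits (suc D) h A B + 2 ^ L * (2 ^ suc D * M) ∎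
        where
        open ℕ.≤-Reasoning
        ih : ∀ m → L * halts D (m ∷ h) A B ≤ bits D (m ∷ h) A B + 2 ^ L * (2 ^ D * M)
        ih m = tradeoff D L (m ∷ h) A B (Bounded-pred {D} {A} {B} bounded) λ x y →
          All.map (All.map λ r → r ◅◅ R.by-coin (C.step-public x y eq) m ◅ ε) (reach x y)
        regroup : ∀ b₀ b₁ k d m →
          (b₀ + k * (d * m)) + (b₁ + k * (d * m)) ≡ b₀ + b₁ + k * (2 * d * m)
        regroup = solve-∀
      go alice eq zero = z≤n
      go alice eq (suc L) = subst (λ k → suc L * halts (suc D) h A B ≤ bits (suc D) h A B + k)
        (double (2 ^ L) (2 ^ D) M)
        (message-cost L (2 ^ L * (2 ^ D * M))
          (trans (total-split C.haltCount-additive)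
            (cong₂ _+_ (halts-send {A = A′ false} {B} (steps reach false))
                       (halts-send {A = A′ true} {B} (steps reach true))))
          (trans (total-split C.bitCount-additive)
            (cong₂ _+_ (bits-send {A = A′ false} {B} (steps reach false))
                       (bits-send {A = A′ true} {B} (steps reach true))))
          (halts-≤ D (false ∷ h) (A′ false) B) (halts-≤ D (true ∷ h) (A′ true) B)
          (ih false) (ih true))
        where
        open AliceSpeaks eq D A B
        ih : ∀ m → L * halts D (m ∷ h) (A′ m) B ≤ bits D (m ∷ h) (A′ m) B + 2 ^ L * (2 ^ D * M)
        ih m = tradeoff D L (m ∷ h) (A′ m) B (bounded′ bounded m)
          (Reach-send {A = A′ m} {B} (steps reach m))
      go bob eq zero = z≤n
      go bob eq (suc L) = subst (λ k → suc L * halts (suc D) h A B ≤ bits (suc D) h A B + k)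
        (double (2 ^ L) (2 ^ D) M)
        (message-cost L (2 ^ L * (2 ^ D * M))
          (trans (total-split C.haltCount-additive)
            (cong₂ _+_ (halts-send {A = A} {B′ false} (steps reach false))
                       (halts-send {A = A} {B′ true} (steps reach true))))
          (trans (total-split C.bitCount-additive)
            (cong₂ _+_ (bits-send {A = A} {B′ false} (steps reach false))
                       (bits-send {A = A} {B′ true} (steps reach true))))
          (halts-≤ D (false ∷ h) A (B′ false)) (halts-≤ D (true ∷ h) A (B′ true))
          (ih false) (ih true))
        where
        open BobSpeaks eq D A B
        ih : ∀ m → L * halts D (m ∷ h) A (B′ m) ≤ bits D (m ∷ h) A (B′ m) + 2 ^ L * (2 ^ D * M)
        ih m = tradeoff D L (m ∷ h) A (B′ m) (bounded′ bounded m)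
          (Reach-send {A = A} {B′ m} (steps reach m))
      -- No bits are left to pay with, so the whole left side goes into the error term; the crude
      -- `L ≤ 2 ^ L` is enough for that.
      go over eq L = begin
        L * halts (suc D) h A B        ≤⟨ ℕ.*-mono-≤ (L≤2^L L) (halts-over eq (suc D) A B bounded reach) ⟩
        2 ^ L * (2 ^ suc D * M)        ≤⟨ ℕ.m≤n+m _ (bits (suc D) h A B) ⟩
        bits (suc D) h A B + 2 ^ L * (2 ^ suc D * M) ∎
        where
        open ℕ.≤-Reasoning
        L≤2^L : ∀ L → L ≤ 2 ^ L
        L≤2^L zero    = z≤n
        L≤2^L (suc L) = ℕ.+-mono-≤ (ℕ.m^n>0 2 L) (ℕ.≤-trans (L≤2^L L) (ℕ.m≤m+n _ 0))

-- The gadget and its obstruction to silent coloring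

module _ where
  open import Data.Nat using (_+_; _*_; _≤_; _^_)

  module _ {α β : Fin 3 → Fin 4 → Fin 3} (apart : ∀ i j v → α i v ≢ β j v) where

    third : ∀ (a b c d : Fin 3) → a ≢ b → c ≢ a → c ≢ b → d ≢ a → d ≢ b → c ≡ d
    third = toWitness {a? = Fin.all? λ a → Fin.all? λ b → Fin.all? λ c → Fin.all? λ d →
      ¬? (a Fin.≟ b) →-dec ¬? (c Fin.≟ a) →-dec ¬? (c Fin.≟ b) →-dec ¬? (d Fin.≟ a) →-dec
      ¬? (d Fin.≟ b) →-dec (c Fin.≟ d)} _

    Constant : (Fin 3 → Fin 4 → Fin 3) → Fin 4 → Set
    Constant γ v = ∀ i j → γ i v ≡ γ j v

    -- The two parties use disjoint nonempty sets of colors at `v`; out of three colors, one of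
    -- these sets is a singleton.
    constant : ∀ v → Constant α v ⊎ Constant β v
    constant v with Fin.all? (λ i → Fin.all? λ j → α i v Fin.≟ α j v)
    ... | yes c = inj₁ c
    ... | no ¬c = inj₂ λ i j → decidable-stable (β i v Fin.≟ β j v) λ βi≢βj →
      ¬c λ i′ j′ → third _ _ _ _ βi≢βj (apart _ _ v) (apart _ _ v) (apart _ _ v) (apart _ _ v)

    -- On four vertices with three colors, Alice's color must be constant at exactly the vertices 0
    -- and 3, or exactly at 1 and 2; in both cases the middle inputs use four colors.
    no-silent-coloring :
      α 0F 0F ≡ α 0F 2F → α 0F 1F ≡ α 0F 3F → α 1F 1F ≢ α 1F 2F → α 1F 0F ≢ α 1F 3F →
      α 2F 1F ≢ α 2F 3F → α 2F 0F ≢ α 2F 2F →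
      β 0F 2F ≢ β 0F 3F → β 0F 0F ≢ β 0F 1F → β 1F 1F ≢ β 1F 2F → β 1F 0F ≢ β 1F 3F →
      β 2F 2F ≡ β 2F 3F → β 2F 0F ≡ β 2F 1F → ⊥
    no-silent-coloring α02 α13 α1-12 α1-03 α2-13 α2-02 β0-23 β0-01 β1-12 β1-03 β23 β01 =
      go (constant 0F) (constant 1F) (constant 2F) (constant 3F)
      where
      go : Constant α 0F ⊎ Constant β 0F → Constant α 1F ⊎ Constant β 1F →
           Constant α 2F ⊎ Constant β 2F → Constant α 3F ⊎ Constant β 3F → ⊥
      -- A party cannot be constant at both ends of an edge between shared vertices: that edge makes
      -- the two constants agree, while under another input the same two ends meet in a private
      -- vertex and must differ.
      go (inj₁ a0) _ (inj₁ a2) _ = α2-02 (trans (a0 2F 0F) (trans α02 (a2 0F 2F)))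
      go _ (inj₁ a1) _ (inj₁ a3) = α2-13 (trans (a1 2F 0F) (trans α13 (a3 0F 2F)))
      go _ _ (inj₂ b2) (inj₂ b3) = β0-23 (trans (b2 0F 2F) (trans β23 (b3 2F 0F)))
      go (inj₂ b0) (inj₂ b1) _ _ = β0-01 (trans (b0 0F 2F) (trans β01 (b1 2F 0F)))
      -- Under the middle inputs Bob's colors at 1 and 2 both avoid Alice's two distinct colors at 0
      -- and 3, hence coincide. Each avoidance carries a constant color along an edge of Alice's
      -- `0F` or Bob's `2F` to a vertex where `apart` applies.
      go (inj₁ a0) (inj₂ b1) (inj₂ b2) (inj₁ a3) = β1-12 (third _ _ _ _ α1-03
        (λ eq → apart 1F 2F 0F (trans (sym eq) (trans (b1 1F 2F) (sym β01))))
        (λ eq → apart 0F 1F 1F (trans α13 (trans (a3 0F 1F) (sym eq))))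
        (λ eq → apart 0F 1F 2F (trans (sym α02) (trans (a0 0F 1F) (sym eq))))
        (λ eq → apart 1F 2F 3F (trans (sym eq) (trans (b2 1F 2F) β23))))
      go (inj₂ b0) (inj₁ a1) (inj₁ a2) (inj₂ b3) = β1-03 (third _ _ _ _ α1-12
        (λ eq → apart 1F 2F 1F (trans (sym eq) (trans (b0 1F 2F) β01)))
        (λ eq → apart 0F 1F 0F (trans α02 (trans (a2 0F 1F) (sym eq))))
        (λ eq → apart 0F 1F 3F (trans (sym α13) (trans (a1 0F 1F) (sym eq))))
        (λ eq → apart 1F 2F 2F (trans (sym eq) (trans (b3 1F 2F) (sym β23)))))

  _has_,_ : List (ℕ × ℕ) → ℕ → ℕ → Bool
  es has u , v = any (λ (a , b) → ((u ℕ.≡ᵇ a) ∧ (v ℕ.≡ᵇ b)) ∨ ((u ℕ.≡ᵇ b) ∧ (v ℕ.≡ᵇ a))) es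

  -- Vertices 0 to 3 are shared, 4 and 5 are Alice's, 6 and 7 are Bob's. Each input pairs up the
  -- shared vertices: an edge forces equal colors at its ends, a path through a private vertex
  -- forces distinct ones. This yields the twelve hypotheses of `no-silent-coloring`.
  edgesOfA edgesOfB : Fin 3 → List (ℕ × ℕ)
  edgesOfA 0F = (0 , 2) ∷ (1 , 3) ∷ []
  edgesOfA 1F = (1 , 4) ∷ (4 , 2) ∷ (0 , 5) ∷ (5 , 3) ∷ []
  edgesOfA 2F = (1 , 4) ∷ (4 , 3) ∷ (0 , 5) ∷ (5 , 2) ∷ []
  edgesOfB 0F = (2 , 6) ∷ (6 , 3) ∷ (0 , 7) ∷ (7 , 1) ∷ []
  edgesOfB 1F = (1 , 6) ∷ (6 , 2) ∷ (0 , 7) ∷ (7 , 3) ∷ []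
  edgesOfB 2F = (2 , 3) ∷ (0 , 1) ∷ []

  gadgetA gadgetB : Fin 3 → SimpleGraph 8
  adj        (gadgetA i) u v = edgesOfA i has toℕ u , toℕ v
  adj-sym    (gadgetA i) = toWitness {a? = Fin.all? λ i → Fin.all? λ u → Fin.all? λ v →
    (edgesOfA i has toℕ u , toℕ v) Bool.≟ (edgesOfA i has toℕ v , toℕ u)} _ i
  adj-irrefl (gadgetA i) = toWitness {a? = Fin.all? λ i → Fin.all? λ u →
    (edgesOfA i has toℕ u , toℕ u) Bool.≟ false} _ i
  adj        (gadgetB i) u v = edgesOfB i has toℕ u , toℕ v
  adj-sym    (gadgetB i) = toWitness {a? = Fin.all? λ i → Fin.all? λ u → Fin.all? λ v →
    (edgesOfB i has toℕ u , toℕ v) Bool.≟ (edgesOfB i has toℕ v , toℕ u)} _ i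
  adj-irrefl (gadgetB i) = toWitness {a? = Fin.all? λ i → Fin.all? λ u →
    (edgesOfB i has toℕ u , toℕ u) Bool.≟ false} _ i

  gadgetA∩gadgetB : ∀ i j u v → adj (gadgetA i) u v ∧ adj (gadgetB j) u v ≡ false
  gadgetA∩gadgetB = toWitness {a? = Fin.all? λ i → Fin.all? λ j → Fin.all? λ u → Fin.all? λ v →
    _ Bool.≟ _} _

  degree-gadget : ∀ i j u → degree (gadgetA i ∪ gadgetB j) u ≤ 2
  degree-gadget = toWitness {a? = Fin.all? λ i → Fin.all? λ j → Fin.all? λ u → _ ℕ.≤? _} _

  degree-gadget-0 : ∀ i j → degree (gadgetA i ∪ gadgetB j) 0F ≡ 2
  degree-gadget-0 = toWitness {a? = Fin.all? λ i → Fin.all? λ j → _ ℕ.≟ _} _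

  maxDegree-gadget : ∀ i j → maxDegree (gadgetA i ∪ gadgetB j) ≡ 2
  maxDegree-gadget = toWitness {a? = Fin.all? λ i → Fin.all? λ j → _ ℕ.≟ _} _

  gadget : Fin 3 → Fin 3 → Input 8 2
  gadget i j = record { edgesA = gadgetA i ; edgesB = gadgetB j
                      ; disjoint = gadgetA∩gadgetB i j ; max-degree = maxDegree-gadget i j }

  combine-A : ∀ {n Δ} (I : Input n Δ) cA cB {u v} → T (adj (edgesA I) u v) →
    combine I cA cB u v ≡ cA u v
  combine-A I cA cB {u} {v} e with true ← adj (edgesA I) u v = refl

  combine-B : ∀ {n Δ} (I : Input n Δ) cA cB {u v} → T (adj (edgesB I) u v) →
    combine I cA cB u v ≡ cB u v
  combine-B I cA cB {u} {v} e with adj (edgesA I) u v | adj (edgesB I) u v | disjoint I u v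
  ... | false | true | _ = refl

  neighborA neighborB : Fin 3 → Fin 4 → Fin 8
  neighborA 0F 0F = 2F
  neighborA 0F 1F = 3F
  neighborA 0F 2F = 0F
  neighborA 0F 3F = 1F
  neighborA 1F 0F = 5F
  neighborA 1F 1F = 4F
  neighborA 1F 2F = 4F
  neighborA 1F 3F = 5F
  neighborA 2F 0F = 5F
  neighborA 2F 1F = 4F
  neighborA 2F 2F = 5F
  neighborA 2F 3F = 4F
  neighborB 0F 0F = 7F
  neighborB 0F 1F = 7F
  neighborB 0F 2F = 6F
  neighborB 0F 3F = 6F
  neighborB 1F 0F = 7F
  neighborB 1F 1F = 6F
  neighborB 1F 2F = 6F
  neighborB 1F 3F = 7F
  neighborB 2F 0F = 1F
  neighborB 2F 1F = 0F
  neighborB 2F 2F = 3F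
  neighborB 2F 3F = 2F

  shared : Fin 4 → Fin 8
  shared v = v ↑ˡ 4

  edge-neighborA : ∀ i v → T (adj (gadgetA i) (shared v) (neighborA i v))
  edge-neighborA = toWitness {a? = Fin.all? λ i → Fin.all? λ v → T? _} _

  edge-neighborB : ∀ i v → T (adj (gadgetB i) (shared v) (neighborB i v))
  edge-neighborB = toWitness {a? = Fin.all? λ i → Fin.all? λ v → T? _} _

  neighbors-differ : ∀ i j v → neighborA i v ≢ neighborB j v
  neighbors-differ = toWitness {a? = Fin.all? λ i → Fin.all? λ j → Fin.all? λ v → ¬? (_ Fin.≟ _)} _

  ∨-introˡ : ∀ {a b} → T a → T (a ∨ b)
  ∨-introˡ {true} _ = tt

  ∨-introʳ : ∀ {a b} → T b → T (a ∨ b)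
  ∨-introʳ {true}  _ = tt
  ∨-introʳ {false} t = t

  gadget-not-silent : (cA cB : Fin 3 → Coloring 8) →
    ¬ (∀ i j → IsProperEdgeColoring (gadgetA i ∪ gadgetB j) 3 (combine (gadget i j) (cA i) (cB j)))
  gadget-not-silent cA cB proper-all = no-silent-coloring {α} {β} apart
    (sameA 0F 0F 2F refl refl) (sameA 0F 1F 3F refl refl)
    (differA 1F 1F 2F refl λ ()) (differA 1F 0F 3F refl λ ())
    (differA 2F 1F 3F refl λ ()) (differA 2F 0F 2F refl λ ())
    (differB 0F 2F 3F refl λ ()) (differB 0F 0F 1F refl λ ())
    (differB 1F 1F 2F refl λ ()) (differB 1F 0F 3F refl λ ())
    (sameB 2F 2F 3F refl refl) (sameB 2F 0F 1F refl refl)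
    where
    open IsProperEdgeColoring
    c : Fin 3 → Fin 3 → Coloring 8
    c i j = combine (gadget i j) (cA i) (cB j)
    eA : ∀ i j v → T (adj (gadgetA i ∪ gadgetB j) (shared v) (neighborA i v))
    eA i j v = ∨-introˡ (edge-neighborA i v)
    eB : ∀ i j v → T (adj (gadgetA i ∪ gadgetB j) (shared v) (neighborB j v))
    eB i j v = ∨-introʳ {adj (gadgetA i) (shared v) (neighborB j v)} (edge-neighborB j v)
    α β : Fin 3 → Fin 4 → Fin 3
    -- The opponent `0F` is an arbitrary choice: on Alice's edges `combine` returns her own color,
    -- so `toℕ-α` holds against every `j`.
    α i v = fromℕ< (in-palette (proper-all i 0F) (eA i 0F v))
    β j v = fromℕ< (in-palette (proper-all 0F j) (eB 0F j v))
    toℕ-α : ∀ i j v → toℕ (α i v) ≡ c i j (shared v) (neighborA i v)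
    toℕ-α i j v = trans (Fin.toℕ-fromℕ< _) (trans
      (combine-A (gadget i 0F) (cA i) (cB 0F) (edge-neighborA i v))
      (sym (combine-A (gadget i j) (cA i) (cB j) (edge-neighborA i v))))
    toℕ-β : ∀ i j v → toℕ (β j v) ≡ c i j (shared v) (neighborB j v)
    toℕ-β i j v = trans (Fin.toℕ-fromℕ< _) (trans
      (combine-B (gadget 0F j) (cA 0F) (cB j) (edge-neighborB j v))
      (sym (combine-B (gadget i j) (cA i) (cB j) (edge-neighborB j v))))
    apart : ∀ i j v → α i v ≢ β j v
    apart i j v eq = proper (proper-all i j) (eA i j v) (eB i j v) (neighbors-differ i j v)
      (trans (sym (toℕ-α i j v)) (trans (cong toℕ eq) (toℕ-β i j v)))
    sameA : ∀ i u v → shared u ≡ neighborA i v → shared v ≡ neighborA i u → α i u ≡ α i v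
    sameA i u v u≡ v≡ = Fin.toℕ-injective (trans (toℕ-α i 0F u) (trans
      (symmetric (proper-all i 0F) (eA i 0F u))
      (trans (cong₂ (c i 0F) (sym v≡) u≡) (sym (toℕ-α i 0F v)))))
    sameB : ∀ j u v → shared u ≡ neighborB j v → shared v ≡ neighborB j u → β j u ≡ β j v
    sameB j u v u≡ v≡ = Fin.toℕ-injective (trans (toℕ-β 0F j u) (trans
      (symmetric (proper-all 0F j) (eB 0F j u))
      (trans (cong₂ (c 0F j) (sym v≡) u≡) (sym (toℕ-β 0F j v)))))
    flip-edge : ∀ i j u v → T (adj (gadgetA i ∪ gadgetB j) u v) → T (adj (gadgetA i ∪ gadgetB j) v u)
    flip-edge i j u v = subst T (adj-sym (gadgetA i ∪ gadgetB j) u v)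
    differA : ∀ i u v → neighborA i u ≡ neighborA i v → shared u ≢ shared v → α i u ≢ α i v
    -- `proper` compares edges leaving a common vertex, so both edges are reversed to start at the
    -- private vertex.
    differA i u v w≡ u≢v eq = proper (proper-all i 0F)
      (flip-edge i 0F (shared u) (neighborA i u) (eA i 0F u))
      (subst (λ w → T (adj (gadgetA i ∪ gadgetB 0F) w (shared v))) (sym w≡)
        (flip-edge i 0F (shared v) (neighborA i v) (eA i 0F v)))
      u≢v (begin
        c i 0F (neighborA i u) (shared u)  ≡⟨ symmetric (proper-all i 0F) (eA i 0F u) ⟨
        c i 0F (shared u) (neighborA i u)  ≡⟨ toℕ-α i 0F u ⟨
        toℕ (α i u)                        ≡⟨ cong toℕ eq ⟩
        toℕ (α i v)                        ≡⟨ toℕ-α i 0F v ⟩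
        c i 0F (shared v) (neighborA i v)  ≡⟨ symmetric (proper-all i 0F) (eA i 0F v) ⟩
        c i 0F (neighborA i v) (shared v)  ≡⟨ cong (λ w → c i 0F w (shared v)) w≡ ⟨
        c i 0F (neighborA i u) (shared v)  ∎)
      where open ≡-Reasoning
    differB : ∀ j u v → neighborB j u ≡ neighborB j v → shared u ≢ shared v → β j u ≢ β j v
    differB j u v w≡ u≢v eq = proper (proper-all 0F j)
      (flip-edge 0F j (shared u) (neighborB j u) (eB 0F j u))
      (subst (λ w → T (adj (gadgetA 0F ∪ gadgetB j) w (shared v))) (sym w≡)
        (flip-edge 0F j (shared v) (neighborB j v) (eB 0F j v)))
      u≢v (begin
        c 0F j (neighborB j u) (shared u)  ≡⟨ symmetric (proper-all 0F j) (eB 0F j u) ⟨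
        c 0F j (shared u) (neighborB j u)  ≡⟨ toℕ-β 0F j u ⟨
        toℕ (β j u)                        ≡⟨ cong toℕ eq ⟩
        toℕ (β j v)                        ≡⟨ toℕ-β 0F j v ⟩
        c 0F j (shared v) (neighborB j v)  ≡⟨ symmetric (proper-all 0F j) (eB 0F j v) ⟩
        c 0F j (neighborB j v) (shared v)  ≡⟨ cong (λ w → c 0F j w (shared v)) w≡ ⟨
        c 0F j (neighborB j u) (shared v)  ∎)
      where open ≡-Reasoning

  -- Disjoint unions of graphs and their degrees

  sumAdj : ∀ {a b} → SimpleGraph a → SimpleGraph b → Fin a ⊎ Fin b → Fin a ⊎ Fin b → Bool
  sumAdj G H (inj₁ u) (inj₁ v) = adj G u v
  sumAdj G H (inj₂ u) (inj₂ v) = adj H u v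
  sumAdj G H (inj₁ _) (inj₂ _) = false
  sumAdj G H (inj₂ _) (inj₁ _) = false

  infixr 6 _⊕_

  _⊕_ : ∀ {a b} → SimpleGraph a → SimpleGraph b → SimpleGraph (a + b)
  adj        (_⊕_ {a} G H) u v = sumAdj G H (splitAt a u) (splitAt a v)
  adj-sym    (_⊕_ {a} G H) u v with splitAt a u | splitAt a v
  ... | inj₁ u′ | inj₁ v′ = adj-sym G u′ v′
  ... | inj₁ _  | inj₂ _  = refl
  ... | inj₂ _  | inj₁ _  = refl
  ... | inj₂ u′ | inj₂ v′ = adj-sym H u′ v′
  adj-irrefl (_⊕_ {a} G H) u with splitAt a u
  ... | inj₁ u′ = adj-irrefl G u′
  ... | inj₂ u′ = adj-irrefl H u′

  edgeless : ∀ n → SimpleGraph n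
  edgeless n = record { adj = λ _ _ → false ; adj-sym = λ _ _ → refl ; adj-irrefl = λ _ → refl }

  ⊕-disjoint : ∀ {a b} {G G′ : SimpleGraph a} {H H′ : SimpleGraph b} →
    (∀ u v → adj G u v ∧ adj G′ u v ≡ false) → (∀ u v → adj H u v ∧ adj H′ u v ≡ false) →
    ∀ u v → adj (G ⊕ H) u v ∧ adj (G′ ⊕ H′) u v ≡ false
  ⊕-disjoint {a} G∩G′ H∩H′ u v with splitAt a u | splitAt a v
  ... | inj₁ u′ | inj₁ v′ = G∩G′ u′ v′
  ... | inj₁ _  | inj₂ _  = refl
  ... | inj₂ _  | inj₁ _  = refl
  ... | inj₂ u′ | inj₂ v′ = H∩H′ u′ v′

  length-filter : ∀ (p : X → Bool) xs → length (filterᵇ p xs) ≡ count p xs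
  length-filter p []       = refl
  length-filter p (x ∷ xs) with p x
  ... | true  = cong suc (length-filter p xs)
  ... | false = length-filter p xs

  tabulate-+ : ∀ a {b} (f : Fin (a + b) → X) →
    tabulate f ≡ tabulate (f ∘ (_↑ˡ b)) ++ tabulate (f ∘ (a ↑ʳ_))
  tabulate-+ zero    f = refl
  tabulate-+ (suc a) f = cong (f zero ∷_) (tabulate-+ a (f ∘ suc))

  count-allFin-+ : ∀ a {b} (p : Fin (a + b) → Bool) →
    count p (allFin (a + b)) ≡ count (p ∘ (_↑ˡ b)) (allFin a) + count (p ∘ (a ↑ʳ_)) (allFin b)
  count-allFin-+ a {b} p = begin
    count p (tabulate id)
      ≡⟨ cong (count p) (tabulate-+ a id) ⟩
    count p (tabulate (_↑ˡ b) ++ tabulate (a ↑ʳ_))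
      ≡⟨ ∑-++ (indicator ∘ p) (tabulate (_↑ˡ b)) (tabulate (a ↑ʳ_)) ⟩
    count p (tabulate (_↑ˡ b)) + count p (tabulate (a ↑ʳ_))
      ≡⟨ cong₂ (λ us vs → count p us + count p vs) (List.map-tabulate id (_↑ˡ b))
           (List.map-tabulate id (a ↑ʳ_)) ⟨
    count p (map (_↑ˡ b) (allFin a)) + count p (map (a ↑ʳ_) (allFin b))
      ≡⟨ cong₂ _+_ (∑-map (_↑ˡ b) (indicator ∘ p) (allFin a)) (∑-map (a ↑ʳ_) (indicator ∘ p) (allFin b)) ⟩
    count (p ∘ (_↑ˡ b)) (allFin a) + count (p ∘ (a ↑ʳ_)) (allFin b) ∎
    where open ≡-Reasoning

  maxDegree-≡ : ∀ {n d} (G : SimpleGraph n) → (∀ u → degree G u ≤ d) → ∀ u → degree G u ≡ d →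
    HasMaxDegree G d
  maxDegree-≡ {n} G ≤d u ≡d = hasMaxDegree (ℕ.≤-antisym
    (max≤v⁺ z≤n (All.map⁺ (All.universal ≤d (allFin n))))
    (v≤max⁺ 0 (map (degree G) (allFin n))
      (inj₂ (Any.map⁺ (lose (∈-allFin u) (ℕ.≤-reflexive (sym ≡d)))))))

  module _ {a b} (G G′ : SimpleGraph a) (H H′ : SimpleGraph b) where

    union : SimpleGraph (a + b)
    union = (G ⊕ H) ∪ (G′ ⊕ H′)

    degree-⊕ˡ : ∀ u → degree union (u ↑ˡ b) ≡ degree (G ∪ G′) u
    degree-⊕ˡ u = begin
      degree union (u ↑ˡ b)
        ≡⟨ length-filter (adj union (u ↑ˡ b)) (allFin (a + b)) ⟩
      count (adj union (u ↑ˡ b)) (allFin (a + b))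
        ≡⟨ count-allFin-+ a (adj union (u ↑ˡ b)) ⟩
      count (adj union (u ↑ˡ b) ∘ (_↑ˡ b)) (allFin a) + count (adj union (u ↑ˡ b) ∘ (a ↑ʳ_)) (allFin b)
        ≡⟨ cong₂ _+_ (∑-cong′ (allFin a) (λ v → cong indicator (left v)))
                     (∑-0 (allFin b) (λ v → cong indicator (right v))) ⟩
      count (adj (G ∪ G′) u) (allFin a) + 0
        ≡⟨ ℕ.+-identityʳ _ ⟩
      count (adj (G ∪ G′) u) (allFin a)
        ≡⟨ length-filter (adj (G ∪ G′) u) (allFin a) ⟨
      degree (G ∪ G′) u ∎
      where
      open ≡-Reasoning
      left : ∀ v → adj union (u ↑ˡ b) (v ↑ˡ b) ≡ adj (G ∪ G′) u v
      left v rewrite Fin.splitAt-↑ˡ a u b | Fin.splitAt-↑ˡ a v b = refl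
      right : ∀ v → adj union (u ↑ˡ b) (a ↑ʳ v) ≡ false
      right v rewrite Fin.splitAt-↑ˡ a u b | Fin.splitAt-↑ʳ a b v = refl

    degree-⊕ʳ : ∀ u → degree union (a ↑ʳ u) ≡ degree (H ∪ H′) u
    degree-⊕ʳ u = begin
      degree union (a ↑ʳ u)
        ≡⟨ length-filter (adj union (a ↑ʳ u)) (allFin (a + b)) ⟩
      count (adj union (a ↑ʳ u)) (allFin (a + b))
        ≡⟨ count-allFin-+ a (adj union (a ↑ʳ u)) ⟩
      count (adj union (a ↑ʳ u) ∘ (_↑ˡ b)) (allFin a) + count (adj union (a ↑ʳ u) ∘ (a ↑ʳ_)) (allFin b)
        ≡⟨ cong₂ _+_ (∑-0 (allFin a) (λ v → cong indicator (left v)))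
                     (∑-cong′ (allFin b) (λ v → cong indicator (right v))) ⟩
      count (adj (H ∪ H′) u) (allFin b)
        ≡⟨ length-filter (adj (H ∪ H′) u) (allFin b) ⟨
      degree (H ∪ H′) u ∎
      where
      open ≡-Reasoning
      left : ∀ v → adj union (a ↑ʳ u) (v ↑ˡ b) ≡ false
      left v rewrite Fin.splitAt-↑ʳ a b u | Fin.splitAt-↑ˡ a v b = refl
      right : ∀ v → adj union (a ↑ʳ u) (a ↑ʳ v) ≡ adj (H ∪ H′) u v
      right v rewrite Fin.splitAt-↑ʳ a b u | Fin.splitAt-↑ʳ a b v = refl

    degree-⊕-≤ : ∀ {d} → (∀ u → degree (G ∪ G′) u ≤ d) → (∀ u → degree (H ∪ H′) u ≤ d) →
      ∀ u → degree union u ≤ d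
    degree-⊕-≤ {d} ≤ˡ ≤ʳ u = go (splitAt a u) refl
      where
      go : ∀ s → splitAt a u ≡ s → degree union u ≤ d
      go (inj₁ u′) eq = subst (λ w → degree union w ≤ d) (Fin.splitAt⁻¹-↑ˡ eq)
        (ℕ.≤-trans (ℕ.≤-reflexive (degree-⊕ˡ u′)) (≤ˡ u′))
      go (inj₂ u′) eq = subst (λ w → degree union w ≤ d) (Fin.splitAt⁻¹-↑ʳ eq)
        (ℕ.≤-trans (ℕ.≤-reflexive (degree-⊕ʳ u′)) (≤ʳ u′))

    maxDegree-⊕ : ∀ {d} → (∀ u → degree (G ∪ G′) u ≤ d) → (∀ u → degree (H ∪ H′) u ≤ d) →
      ∀ u → degree (G ∪ G′) u ≡ d →
      HasMaxDegree ((G ⊕ H) ∪ (G′ ⊕ H′)) d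
    maxDegree-⊕ ≤ˡ ≤ʳ u eq =
      maxDegree-≡ union (degree-⊕-≤ ≤ˡ ≤ʳ) (u ↑ˡ b) (trans (degree-⊕ˡ u) eq)

  -- Many gadgets, and the size of rectangles of words

  Word : ℕ → Set
  Word = Vec (Fin 3)

  -- The `r` isolated vertices allow vertex counts that are not multiples of eight.
  gadgets : ∀ {m} → (Fin 3 → SimpleGraph 8) → ∀ r → Word m → SimpleGraph (m * 8 + r)
  gadgets g r []      = edgeless r
  gadgets g r (i ∷ w) = g i ⊕ gadgets g r w

  gadgets-disjoint : ∀ {m} r (x y : Word m) u v →
    adj (gadgets gadgetA r x) u v ∧ adj (gadgets gadgetB r y) u v ≡ false
  gadgets-disjoint r []      []      u v = refl
  gadgets-disjoint r (i ∷ x) (j ∷ y) =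
    ⊕-disjoint {G = gadgetA i} {gadgetB j} {gadgets gadgetA r x} {gadgets gadgetB r y}
      (gadgetA∩gadgetB i j) (gadgets-disjoint r x y)

  degree-gadgets : ∀ {m} r (x y : Word m) u → degree (gadgets gadgetA r x ∪ gadgets gadgetB r y) u ≤ 2
  degree-gadgets r []      []      u =
    ℕ.≤-trans (ℕ.≤-reflexive (trans (length-filter _ (allFin r)) (∑-0 (allFin r) λ _ → refl))) z≤n
  degree-gadgets r (i ∷ x) (j ∷ y) =
    degree-⊕-≤ (gadgetA i) (gadgetB j) (gadgets gadgetA r x) (gadgets gadgetB r y)
      (degree-gadget i j) (degree-gadgets r x y)

  maxDegree-gadgets : ∀ {m} r (x y : Word (suc m)) →
    HasMaxDegree (gadgets gadgetA r x ∪ gadgets gadgetB r y) 2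
  maxDegree-gadgets r (i ∷ x) (j ∷ y) =
    maxDegree-⊕ (gadgetA i) (gadgetB j) (gadgets gadgetA r x) (gadgets gadgetB r y)
      (degree-gadget i j) (degree-gadgets r x y) 0F (degree-gadget-0 i j)

  vertex : ∀ {m} r → Fin m → Fin 8 → Fin (m * 8 + r)
  vertex {suc m} r zero    u = u ↑ˡ (m * 8 + r)
  vertex {suc m} r (suc i) u = 8 ↑ʳ vertex r i u

  vertex-injective : ∀ {m} r (i : Fin m) {u v} → vertex r i u ≡ vertex r i v → u ≡ v
  vertex-injective {suc m} r zero    {u} {v} eq = Fin.↑ˡ-injective (m * 8 + r) u v eq
  vertex-injective {suc m} r (suc i) eq = vertex-injective r i (Fin.↑ʳ-injective 8 _ _ eq)

  adj-vertex : ∀ {m} g r (w : Word m) i u v →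
    adj (gadgets g r w) (vertex r i u) (vertex r i v) ≡ adj (g (lookup w i)) u v
  adj-vertex {suc m} g r (k ∷ w) zero u v
    rewrite Fin.splitAt-↑ˡ 8 u (m * 8 + r) | Fin.splitAt-↑ˡ 8 v (m * 8 + r) = refl
  adj-vertex {suc m} g r (k ∷ w) (suc i) u v = adj-vertex g r w i u v

  words : ∀ m → List (Word m)
  words zero    = [] ∷ []
  words (suc m) = concatMap (λ v → map (v ∷_) (words m)) (allFin 3)

  ∈-words : ∀ {m} (w : Word m) → w ∈ words m
  ∈-words []      = here refl
  ∈-words (v ∷ w) = ∈-concatMap⁺ (λ v → map (v ∷_) (words _))
    (lose (∈-allFin v) (∈-map⁺ (v ∷_) (∈-words w)))

  ∑-words : ∀ m (f : Word (suc m) → ℕ) →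
    ∑ (words (suc m)) f ≡ ∑ (allFin 3) λ v → ∑ (words m) (f ∘ (v ∷_))
  ∑-words m f = trans (∑-concatMap (λ v → map (v ∷_) (words m)) f (allFin 3))
    (∑-cong′ (allFin 3) λ v → ∑-map (v ∷_) f (words m))

  ∑-words-1 : ∀ m → ∑ (words m) (λ _ → 1) ≡ 3 ^ m
  ∑-words-1 zero    = refl
  ∑-words-1 (suc m) = trans (∑-words m _) (∑-cong′ (allFin 3) λ _ → ∑-words-1 m)

  Misses : ∀ {m} → (Word m → Bool) → Fin m → Set
  Misses p i = ∃[ v ] ∀ w → T (p w) → lookup w i ≢ v

  -- Per coordinate only 2 · 3 of the 3 · 3 pairs of values can occur.
  rectangle-bound : ∀ m (p q : Word m → Bool) → (∀ i → Misses p i ⊎ Misses q i) →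
    count p (words m) * count q (words m) ≤ 6 ^ m
  rectangle-bound zero    p q misses = ℕ.*-mono-≤ (indicator-≤1 (p [])) (indicator-≤1 (q []))
    where
    indicator-≤1 : ∀ b → indicator b + 0 ≤ 1
    indicator-≤1 true  = ℕ.≤-refl
    indicator-≤1 false = z≤n
  rectangle-bound (suc m) p q misses = begin
    count p (words (suc m)) * count q (words (suc m))
      ≡⟨ cong₂ _*_ (∑-words m (indicator ∘ p)) (∑-words m (indicator ∘ q)) ⟩
    ∑ (allFin 3) P * ∑ (allFin 3) Q
      ≤⟨ bound (misses zero) ⟩
    6 ^ suc m ∎
    where
    open ℕ.≤-Reasoning
    P Q : Fin 3 → ℕ
    P v = count (p ∘ (v ∷_)) (words m)
    Q v = count (q ∘ (v ∷_)) (words m)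
    misses-∷ : ∀ {p : Word (suc m) → Bool} {i} v → Misses p (suc i) → Misses (p ∘ (v ∷_)) i
    misses-∷ v (k , miss) = k , λ w → miss (v ∷ w)
    PQ≤ : ∀ v w → P v * Q w ≤ 6 ^ m
    PQ≤ v w = rectangle-bound m _ _ λ i → Sum.map (misses-∷ v) (misses-∷ w) (misses (suc i))
    missed : ∀ (p : Word (suc m) → Bool) v → (∀ w → T (p w) → lookup w zero ≢ v) →
      count (p ∘ (v ∷_)) (words m) ≡ 0
    missed p v miss = ∑-0 (words m) λ w → vanish w (p (v ∷ w)) refl
      where
      vanish : ∀ w b → p (v ∷ w) ≡ b → indicator b ≡ 0
      vanish w false _  = refl
      vanish w true  eq = contradiction refl (miss (v ∷ w) (subst T (sym eq) tt))
    sum-bound : ∀ (P Q : Fin 3 → ℕ) v → P v ≡ 0 → (∀ v w → P v * Q w ≤ 6 ^ m) →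
      ∑ (allFin 3) P * ∑ (allFin 3) Q ≤ 6 ^ suc m
    sum-bound P Q v Pv≡0 PQ≤ = begin
      ∑ (allFin 3) P * ∑ (allFin 3) Q
        ≡⟨ ∑₂-* P Q (allFin 3) (allFin 3) ⟨
      (∑ (allFin 3) λ u → ∑ (allFin 3) λ w → P u * Q w)
        ≤⟨ ∑-mono′ (allFin 3) (λ u → ∑-mono′ (allFin 3) (entry u)) ⟩
      (∑ (allFin 3) λ u → ∑ (allFin 3) λ w → nonzero u * 6 ^ m)
        ≡⟨ six v (6 ^ m) ⟩
      6 ^ suc m ∎
      where
      nonzeroAt : Fin 3 → Fin 3 → ℕ
      nonzeroAt v u = indicator (not (toℕ u ℕ.≡ᵇ toℕ v))
      nonzero = nonzeroAt v
      entry : ∀ u w → P u * Q w ≤ nonzero u * 6 ^ m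
      entry u w with toℕ u ℕ.≡ᵇ toℕ v in eq
      ... | false = ℕ.≤-trans (PQ≤ u w) (ℕ.≤-reflexive (sym (ℕ.+-identityʳ _)))
      ... | true with refl ← Fin.toℕ-injective (ℕ.≡ᵇ⇒≡ (toℕ u) (toℕ v) (subst T (sym eq) tt))
        rewrite Pv≡0 = z≤n
      two-rows : ∀ k → 1 * k + (1 * k + (1 * k + 0)) + (1 * k + (1 * k + (1 * k + 0)) + 0) ≡ 6 * k
      two-rows = solve-∀
      six : ∀ v k → (∑ (allFin 3) λ u → ∑ (allFin 3) λ w → nonzeroAt v u * k) ≡ 6 * k
      six 0F = two-rows
      six 1F = two-rows
      six 2F = two-rows
    bound : Misses p zero ⊎ Misses q zero → ∑ (allFin 3) P * ∑ (allFin 3) Q ≤ 6 ^ suc m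
    bound (inj₁ (v , miss)) = sum-bound P Q v (missed p v miss) PQ≤
    bound (inj₂ (v , miss)) = ℕ.≤-trans (ℕ.≤-reflexive (ℕ.*-comm (∑ (allFin 3) P) (∑ (allFin 3) Q)))
      (sum-bound Q P v (missed q v miss) λ w u →
        ℕ.≤-trans (ℕ.≤-reflexive (ℕ.*-comm (Q w) (P u))) (PQ≤ u w))

  -- Decidable by search through `words m`; the words found when all values are hit supply the
  -- inputs for restricting to one gadget.
  misses-or-hits : ∀ {m} (p : Word m → Bool) i →
    Misses p i ⊎ (∀ v → ∃[ w ] T (p w) × lookup w i ≡ v)
  misses-or-hits {m} p i = decide (Fin.any? λ v → ¬? (hit? v))
    where
    hit? : ∀ v → Dec (Any (λ w → T (p w) × lookup w i ≡ v) (words m))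
    hit? v = Any.any? (λ w → T? (p w) ×-dec (lookup w i Fin.≟ v)) (words m)
    decide : Dec (∃[ v ] ¬ Any (λ w → T (p w) × lookup w i ≡ v) (words m)) →
      Misses p i ⊎ (∀ v → ∃[ w ] T (p w) × lookup w i ≡ v)
    decide (yes (v , none)) = inj₁ (v , λ w pw eq → none (lose (∈-words w) (pw , eq)))
    decide (no hits) = inj₂ λ v →
      let (w , _ , h) = find (decidable-stable (hit? v) λ none → hits (v , none)) in w , h

-- Restriction to one gadget, and averaging tools

module _ where
  open import Data.Nat using (_+_; _*_; _≤_; _^_)

  proper-pullback : ∀ {k n K} {G₀ : SimpleGraph k} {G : SimpleGraph n} {c₀ c} (f : Fin k → Fin n) →
    (∀ {u v} → f u ≡ f v → u ≡ v) →
    (∀ u v → adj G (f u) (f v) ≡ adj G₀ u v) → (∀ u v → c (f u) (f v) ≡ c₀ u v) →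
    IsProperEdgeColoring G K c → IsProperEdgeColoring G₀ K c₀
  proper-pullback {G₀ = G₀} {G} f f-inj adj≡ c≡ p = record
    { symmetric  = λ {u} {v} e → trans (sym (c≡ u v)) (trans (symmetric p (edge e)) (c≡ v u))
    ; in-palette = λ {u} {v} e → subst (ℕ._< _) (c≡ u v) (in-palette p (edge e))
    ; proper     = λ {u} {v} {w} e e′ v≢w eq → proper p (edge e) (edge e′) (v≢w ∘ f-inj)
        (trans (c≡ u v) (trans eq (sym (c≡ u w))))
    }
    where
    open IsProperEdgeColoring
    edge : ∀ {u v} → T (adj G₀ u v) → T (adj G (f u) (f v))
    edge {u} {v} = subst T (sym (adj≡ u v))

  gadgetsInput : ∀ {m} r (x y : Word (suc m)) → Input (suc m * 8 + r) 2
  gadgetsInput r x y = partitionedInput (gadgets gadgetA r x) (gadgets gadgetB r y)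
    (gadgets-disjoint r x y) (maxDegree-gadgets r x y)

  -- If the words on both sides took all three values in some coordinate, the outputs on that gadget
  -- would color it without communication.
  gadgets-silent : ∀ {m} r (p q : Word (suc m) → Bool) (cA cB : Word (suc m) → Coloring (suc m * 8 + r)) →
    (∀ x y → T (p x) → T (q y) → IsProperEdgeColoring (gadgets gadgetA r x ∪ gadgets gadgetB r y) 3
      (combine (gadgetsInput r x y) (cA x) (cB y))) →
    count p (words (suc m)) * count q (words (suc m)) ≤ 6 ^ suc m
  gadgets-silent {m} r p q cA cB proper-all = rectangle-bound (suc m) p q λ i →
    decide i (misses-or-hits p i) (misses-or-hits q i)
    where
    decide : ∀ i → Misses p i ⊎ (∀ v → ∃[ w ] T (p w) × lookup w i ≡ v) →
      Misses q i ⊎ (∀ v → ∃[ w ] T (q w) × lookup w i ≡ v) → Misses p i ⊎ Misses q i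
    decide i (inj₁ miss) _ = inj₁ miss
    decide i _ (inj₁ miss) = inj₂ miss
    decide i (inj₂ hitA) (inj₂ hitB) = contradiction proper-gadget
      (gadget-not-silent (restrict ∘ cA ∘ proj₁ ∘ hitA) (restrict ∘ cB ∘ proj₁ ∘ hitB))
      where
      restrict : Coloring (suc m * 8 + r) → Coloring 8
      restrict c u v = c (vertex r i u) (vertex r i v)
      proper-gadget : ∀ k l → IsProperEdgeColoring (gadgetA k ∪ gadgetB l) 3
        (combine (gadget k l) (restrict (cA (proj₁ (hitA k)))) (restrict (cB (proj₁ (hitB l)))))
      proper-gadget k l =
        let (x , px , x≡) = hitA k
            (y , qy , y≡) = hitB l
            adjA u v = trans (adj-vertex gadgetA r x i u v) (cong (λ k → adj (gadgetA k) u v) x≡)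
            adjB u v = trans (adj-vertex gadgetB r y i u v) (cong (λ k → adj (gadgetB k) u v) y≡)
        in proper-pullback (vertex r i) (vertex-injective r i)
             (λ u v → cong₂ _∨_ (adjA u v) (adjB u v))
             (λ u v → cong (λ b → if b then restrict (cA x) u v else restrict (cB y) u v) (adjA u v))
             (proper-all x y px qy)

  average : ∀ c (f : X → ℕ) xs → 1 ≤ ∑ xs (λ _ → 1) → ∑ xs (λ _ → 1) * c ≤ ∑ xs f → ∃[ x ] c ≤ f x
  average c f (x ∷ xs) _ avg with c ℕ.≤? f x
  ... | yes c≤ = x , c≤
  average c f (x ∷ []) _ avg | no c≰ = x , subst₂ _≤_ (ℕ.+-identityʳ c) (ℕ.+-identityʳ (f x)) avg
  average c f (x ∷ xs@(_ ∷ _)) _ avg | no c≰ =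
    average c f xs (s≤s z≤n)
      (ℕ.+-cancelˡ-≤ c _ _ (ℕ.≤-trans avg (ℕ.+-monoˡ-≤ (∑ xs f) (ℕ.<⇒≤ (ℕ.≰⇒> c≰)))))

  -- Almost sure halting gives a time for each input, but the tradeoff sums over all inputs at a
  -- single time.
  uniform : ∀ (Q : X → ℕ → Set) → (∀ x t → Q x t → Q x (suc t)) → (∀ x → ∃[ t ] Q x t) →
    ∀ xs → ∃[ t ] All (λ x → Q x t) xs
  uniform Q mono ex []       = 0 , []
  uniform Q mono ex (x ∷ xs) =
    let (t , q)  = ex x
        (s , qs) = uniform Q mono ex xs
    in s + t , later s q ∷ All.map (λ {x} q′ → subst (Q x) (ℕ.+-comm t s) (later t q′)) qs
    where
    later : ∀ s {x t} → Q x t → Q x (s + t)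
    later zero    q = q
    later (suc s) {x} {t} q = mono x (s + t) (later s q)

  -- One bit at most doubles the number of silent rectangles, while two gadgets cut each to 36 of 81
  -- pairs. Since `2 * 36 = 72 ≤ 81`, two gadgets per bit suffice, whereas one would not:
  -- `2 * 6 > 9`.
  72^≤81^ : ∀ k → 2 ^ k * 6 ^ (k * 2) ≤ 3 ^ (k * 2) * 3 ^ (k * 2)
  72^≤81^ zero    = ℕ.≤-refl
  72^≤81^ (suc k) = begin
    2 * 2 ^ k * (6 * (6 * 6 ^ (k * 2)))   ≡⟨ lemma₁ (2 ^ k) (6 ^ (k * 2)) ⟩
    72 * (2 ^ k * 6 ^ (k * 2))            ≤⟨ ℕ.*-mono-≤ (ℕ.m≤n+m 72 9) (72^≤81^ k) ⟩
    81 * (3 ^ (k * 2) * 3 ^ (k * 2))      ≡⟨ lemma₂ (3 ^ (k * 2)) ⟩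
    3 * (3 * 3 ^ (k * 2)) * (3 * (3 * 3 ^ (k * 2))) ∎
    where
    open ℕ.≤-Reasoning
    lemma₁ : ∀ a b → 2 * a * (6 * (6 * b)) ≡ 72 * (a * b)
    lemma₁ = solve-∀
    lemma₂ : ∀ a → 81 * (a * a) ≡ 3 * (3 * a) * (3 * (3 * a))
    lemma₂ = solve-∀

-- From counts back to rational probabilities

module _ where
  open import Data.Rational using (ℚ; 0ℚ; 1ℚ; ½; _+_; _-_; _*_; _≤_; _<_; -_; _/_)

  fromℚᵘ-+ : ∀ p q → ℚ.fromℚᵘ (p ℚᵘ.+ q) ≡ ℚ.fromℚᵘ p + ℚ.fromℚᵘ q
  fromℚᵘ-+ p q = ℚ.toℚᵘ-injective (begin
    ℚ.toℚᵘ (ℚ.fromℚᵘ (p ℚᵘ.+ q))                        ≈⟨ ℚ.toℚᵘ-fromℚᵘ (p ℚᵘ.+ q) ⟩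
    p ℚᵘ.+ q                                            ≈⟨ ℚᵘ.+-cong (ℚ.toℚᵘ-fromℚᵘ p) (ℚ.toℚᵘ-fromℚᵘ q) ⟨
    ℚ.toℚᵘ (ℚ.fromℚᵘ p) ℚᵘ.+ ℚ.toℚᵘ (ℚ.fromℚᵘ q)        ≈⟨ ℚ.toℚᵘ-homo-+ (ℚ.fromℚᵘ p) (ℚ.fromℚᵘ q) ⟨
    ℚ.toℚᵘ (ℚ.fromℚᵘ p + ℚ.fromℚᵘ q)                    ∎)
    where open ℚᵘ.≃-Reasoning

  fromℚᵘ-* : ∀ p q → ℚ.fromℚᵘ (p ℚᵘ.* q) ≡ ℚ.fromℚᵘ p * ℚ.fromℚᵘ q
  fromℚᵘ-* p q = ℚ.toℚᵘ-injective (begin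
    ℚ.toℚᵘ (ℚ.fromℚᵘ (p ℚᵘ.* q))                        ≈⟨ ℚ.toℚᵘ-fromℚᵘ (p ℚᵘ.* q) ⟩
    p ℚᵘ.* q                                            ≈⟨ ℚᵘ.*-cong (ℚ.toℚᵘ-fromℚᵘ p) (ℚ.toℚᵘ-fromℚᵘ q) ⟨
    ℚ.toℚᵘ (ℚ.fromℚᵘ p) ℚᵘ.* ℚ.toℚᵘ (ℚ.fromℚᵘ q)        ≈⟨ ℚ.toℚᵘ-homo-* (ℚ.fromℚᵘ p) (ℚ.fromℚᵘ q) ⟨
    ℚ.toℚᵘ (ℚ.fromℚᵘ p * ℚ.fromℚᵘ q)                    ∎)
    where open ℚᵘ.≃-Reasoning

  fromℕᵘ : ℕ → ℚᵘ.ℚᵘ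
  fromℕᵘ a = ℚᵘ.mkℚᵘ (ℤ.+ a) 0

  fromℕ-+ : ∀ a b → fromℕ (a ℕ.+ b) ≡ fromℕ a + fromℕ b
  fromℕ-+ a b = trans (ℚ.fromℚᵘ-cong {fromℕᵘ (a ℕ.+ b)} {fromℕᵘ a ℚᵘ.+ fromℕᵘ b}
      (ℚᵘ.*≡* (cong (ℤ._* ℤ.+ 1) (sym (cong₂ ℤ._+_ (ℤ.*-identityʳ (ℤ.+ a)) (ℤ.*-identityʳ (ℤ.+ b)))))))
    (fromℚᵘ-+ (fromℕᵘ a) (fromℕᵘ b))

  fromℕ-* : ∀ a b → fromℕ (a ℕ.* b) ≡ fromℕ a * fromℕ b
  fromℕ-* a b = trans (ℚ.fromℚᵘ-cong {fromℕᵘ (a ℕ.* b)} {fromℕᵘ a ℚᵘ.* fromℕᵘ b}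
      (ℚᵘ.*≡* (cong (ℤ._* ℤ.+ 1) (ℤ.pos-* a b))))
    (fromℚᵘ-* (fromℕᵘ a) (fromℕᵘ b))

  fromℕ-mono-≤ : ∀ {a b} → a ℕ.≤ b → fromℕ a ≤ fromℕ b
  fromℕ-mono-≤ {a} {b} a≤b = ℚ.toℚᵘ-cancel-≤ (begin
    ℚ.toℚᵘ (fromℕ a)  ≃⟨ ℚ.toℚᵘ-fromℚᵘ (fromℕᵘ a) ⟩
    fromℕᵘ a          ≤⟨ ℚᵘ.*≤* (ℤ.*-monoʳ-≤-nonNeg (ℤ.+ 1) (ℤ.+≤+ a≤b)) ⟩
    fromℕᵘ b          ≃⟨ ℚ.toℚᵘ-fromℚᵘ (fromℕᵘ b) ⟨
    ℚ.toℚᵘ (fromℕ b)  ∎)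
    where open ℚᵘ.≤-Reasoning

  fromℕ-cancel-≤ : ∀ {a b} → fromℕ a ≤ fromℕ b → a ℕ.≤ b
  fromℕ-cancel-≤ {a} {b} a≤b = ℤ.drop‿+≤+ (ℤ.*-cancelʳ-≤-pos (ℤ.+ a) (ℤ.+ b) (ℤ.+ 1) (ℚᵘ.drop-*≤* (begin
    fromℕᵘ a          ≃⟨ ℚ.toℚᵘ-fromℚᵘ (fromℕᵘ a) ⟨
    ℚ.toℚᵘ (fromℕ a)  ≤⟨ ℚ.toℚᵘ-mono-≤ a≤b ⟩
    ℚ.toℚᵘ (fromℕ b)  ≃⟨ ℚ.toℚᵘ-fromℚᵘ (fromℕᵘ b) ⟩
    fromℕᵘ b          ∎)))
    where open ℚᵘ.≤-Reasoning

  fromℕ-suc-positive : ∀ a → ℚ.Positive (fromℕ (suc a))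
  fromℕ-suc-positive a = ℚ.normalize-pos (suc a) 1

  fromℕ-2^-positive : ∀ t → ℚ.Positive (fromℕ (2 ℕ.^ t))
  fromℕ-2^-positive t with 2 ℕ.^ t | ℕ.m^n>0 2 t
  ... | suc k | _ = fromℕ-suc-positive k

  double-half : ∀ a p → fromℕ (2 ℕ.* a) * (½ * p) ≡ fromℕ a * p
  double-half a p = begin
    fromℕ (2 ℕ.* a) * (½ * p)
      ≡⟨ cong (λ q → q * (½ * p)) (trans (cong fromℕ (ℕ.*-comm 2 a)) (fromℕ-* a 2)) ⟩
    fromℕ a * fromℕ 2 * (½ * p)   ≡⟨ ℚ.*-assoc (fromℕ a) (fromℕ 2) (½ * p) ⟩
    fromℕ a * (fromℕ 2 * (½ * p)) ≡⟨ cong (fromℕ a *_) (ℚ.*-assoc (fromℕ 2) ½ p) ⟨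
    fromℕ a * (1ℚ * p)            ≡⟨ cong (fromℕ a *_) (ℚ.*-identityˡ p) ⟩
    fromℕ a * p                   ∎
    where open ≡-Reasoning

  module _ {n Δ} (P : Protocol n Δ) (I : Input n Δ) where
    open Counting P I
    open Run P I

    haltCount-haltProb : ∀ t s → fromℕ (haltCount t s) ≡ fromℕ (2 ℕ.^ t) * haltProb t s
    haltCount-haltProb zero    s = refl
    haltCount-haltProb (suc t) s with step s
    ... | coin k   = begin
      fromℕ (haltCount t (k false) ℕ.+ haltCount t (k true))
        ≡⟨ fromℕ-+ (haltCount t (k false)) (haltCount t (k true)) ⟩
      fromℕ (haltCount t (k false)) + fromℕ (haltCount t (k true))
        ≡⟨ cong₂ _+_ (haltCount-haltProb t (k false)) (haltCount-haltProb t (k true)) ⟩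
      fromℕ (2 ℕ.^ t) * haltProb t (k false) + fromℕ (2 ℕ.^ t) * haltProb t (k true)
        ≡⟨ ℚ.*-distribˡ-+ (fromℕ (2 ℕ.^ t)) _ _ ⟨
      fromℕ (2 ℕ.^ t) * (haltProb t (k false) + haltProb t (k true))
        ≡⟨ double-half (2 ℕ.^ t) _ ⟨
      fromℕ (2 ℕ.^ suc t) * (½ * (haltProb t (k false) + haltProb t (k true))) ∎
      where open ≡-Reasoning
    ... | send s′  = begin
      fromℕ (2 ℕ.* haltCount t s′)                ≡⟨ fromℕ-* 2 (haltCount t s′) ⟩
      fromℕ 2 * fromℕ (haltCount t s′)            ≡⟨ cong (fromℕ 2 *_) (haltCount-haltProb t s′) ⟩
      fromℕ 2 * (fromℕ (2 ℕ.^ t) * haltProb t s′) ≡⟨ ℚ.*-assoc (fromℕ 2) (fromℕ (2 ℕ.^ t)) _ ⟨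
      fromℕ 2 * fromℕ (2 ℕ.^ t) * haltProb t s′   ≡⟨ cong (_* haltProb t s′) (fromℕ-* 2 (2 ℕ.^ t)) ⟨
      fromℕ (2 ℕ.^ suc t) * haltProb t s′         ∎
      where open ≡-Reasoning
    ... | halt _ _ = sym (ℚ.*-identityʳ _)

    bitCount-expectedBits : ∀ t s → fromℕ (bitCount t s) ≡ fromℕ (2 ℕ.^ t) * expectedBits t s
    bitCount-expectedBits zero    s = refl
    bitCount-expectedBits (suc t) s with step s
    ... | coin k   = begin
      fromℕ (bitCount t (k false) ℕ.+ bitCount t (k true))
        ≡⟨ fromℕ-+ (bitCount t (k false)) (bitCount t (k true)) ⟩
      fromℕ (bitCount t (k false)) + fromℕ (bitCount t (k true))
        ≡⟨ cong₂ _+_ (bitCount-expectedBits t (k false)) (bitCount-expectedBits t (k true)) ⟩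
      fromℕ (2 ℕ.^ t) * expectedBits t (k false) + fromℕ (2 ℕ.^ t) * expectedBits t (k true)
        ≡⟨ ℚ.*-distribˡ-+ (fromℕ (2 ℕ.^ t)) _ _ ⟨
      fromℕ (2 ℕ.^ t) * (expectedBits t (k false) + expectedBits t (k true))
        ≡⟨ double-half (2 ℕ.^ t) _ ⟨
      fromℕ (2 ℕ.^ suc t) * (½ * (expectedBits t (k false) + expectedBits t (k true))) ∎
      where open ≡-Reasoning
    ... | send s′  = begin
      fromℕ (2 ℕ.* (2 ℕ.^ t ℕ.+ bitCount t s′))
        ≡⟨ fromℕ-* 2 (2 ℕ.^ t ℕ.+ bitCount t s′) ⟩
      fromℕ 2 * fromℕ (2 ℕ.^ t ℕ.+ bitCount t s′)
        ≡⟨ cong (fromℕ 2 *_) (fromℕ-+ (2 ℕ.^ t) (bitCount t s′)) ⟩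
      fromℕ 2 * (fromℕ (2 ℕ.^ t) + fromℕ (bitCount t s′))
        ≡⟨ cong₂ (λ p q → fromℕ 2 * (p + q)) (sym (ℚ.*-identityʳ (fromℕ (2 ℕ.^ t))))
             (bitCount-expectedBits t s′) ⟩
      fromℕ 2 * (fromℕ (2 ℕ.^ t) * 1ℚ + fromℕ (2 ℕ.^ t) * expectedBits t s′)
        ≡⟨ cong (fromℕ 2 *_) (ℚ.*-distribˡ-+ (fromℕ (2 ℕ.^ t)) 1ℚ _) ⟨
      fromℕ 2 * (fromℕ (2 ℕ.^ t) * (1ℚ + expectedBits t s′))
        ≡⟨ ℚ.*-assoc (fromℕ 2) (fromℕ (2 ℕ.^ t)) _ ⟨
      fromℕ 2 * fromℕ (2 ℕ.^ t) * (1ℚ + expectedBits t s′)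
        ≡⟨ cong (_* (1ℚ + expectedBits t s′)) (fromℕ-* 2 (2 ℕ.^ t)) ⟨
      fromℕ (2 ℕ.^ suc t) * (1ℚ + expectedBits t s′) ∎
      where open ≡-Reasoning
    ... | halt _ _ = sym (ℚ.*-zeroʳ (fromℕ (2 ℕ.^ suc t)))

    -- A halted run stays halted, so halting probabilities are monotone in `t`; this is the
    -- monotonicity that `uniform` asks for.
    haltCount-suc : ∀ t s → 2 ℕ.* haltCount t s ℕ.≤ haltCount (suc t) s
    haltCount-suc zero    s = z≤n
    haltCount-suc (suc t) s with step s
    ... | coin k   = ℕ.≤-trans (ℕ.≤-reflexive (ℕ.*-distribˡ-+ 2 (haltCount t (k false)) _))
                       (ℕ.+-mono-≤ (haltCount-suc t (k false)) (haltCount-suc t (k true)))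
    ... | send s′  = ℕ.*-monoʳ-≤ 2 (haltCount-suc t s′)
    ... | halt _ _ = ℕ.≤-refl

    -- Halting by time `t` with probability at least `L / (L + 1)`, cleared of denominators.
    MostlyHalts : ℕ → ℕ → Set
    MostlyHalts L t = L ℕ.* 2 ℕ.^ t ℕ.≤ suc L ℕ.* haltCount t start

    MostlyHalts-suc : ∀ L t → MostlyHalts L t → MostlyHalts L (suc t)
    MostlyHalts-suc L t p = begin
      L ℕ.* (2 ℕ.* 2 ℕ.^ t)                   ≡⟨ swap L 2 (2 ℕ.^ t) ⟩
      2 ℕ.* (L ℕ.* 2 ℕ.^ t)                   ≤⟨ ℕ.*-monoʳ-≤ 2 p ⟩
      2 ℕ.* (suc L ℕ.* haltCount t start)     ≡⟨ swap (suc L) 2 (haltCount t start) ⟨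
      suc L ℕ.* (2 ℕ.* haltCount t start)     ≤⟨ ℕ.*-monoʳ-≤ (suc L) (haltCount-suc t start) ⟩
      suc L ℕ.* haltCount (suc t) start       ∎
      where
      open ℕ.≤-Reasoning hiding (start)
      swap : ∀ a b c → a ℕ.* (b ℕ.* c) ≡ b ℕ.* (a ℕ.* c)
      swap = solve-∀

    halts⇒MostlyHalts : HaltsAlmostSurely → ∀ L → ∃[ t ] MostlyHalts L t
    halts⇒MostlyHalts halts L =
      let (t , 1-δ≤) = halts δ (ℚ.positive⁻¹ δ {{ℚ.normalize-pos 1 (suc L)}})
      in t , fromℕ-cancel-≤ {L ℕ.* 2 ℕ.^ t} {suc L ℕ.* haltCount t start} (scale t 1-δ≤)
      where
      -- Chosen so that `1 - δ` is `L / (L + 1)`.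
      δ = ℤ.+ 1 / suc L
      unit : fromℕ (suc L) * δ ≡ 1ℚ
      unit = trans (sym (fromℚᵘ-* (fromℕᵘ (suc L)) (ℚᵘ.mkℚᵘ (ℤ.+ 1) L)))
        (ℚ.fromℚᵘ-cong {fromℕᵘ (suc L) ℚᵘ.* ℚᵘ.mkℚᵘ (ℤ.+ 1) L} {fromℕᵘ 1} (ℚᵘ.*≡* (cong ℤ.+_ (lemma L))))
        where
        lemma : ∀ L → suc L ℕ.* 1 ℕ.* 1 ≡ 1 ℕ.* (1 ℕ.* suc L)
        lemma = solve-∀
      scaled : fromℕ (suc L) * (1ℚ - δ) ≡ fromℕ L
      scaled = begin
        fromℕ (suc L) * (1ℚ - δ)                        ≡⟨ ℚ.*-distribˡ-+ (fromℕ (suc L)) 1ℚ (- δ) ⟩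
        fromℕ (suc L) * 1ℚ + fromℕ (suc L) * - δ
          ≡⟨ cong₂ _+_ (ℚ.*-identityʳ (fromℕ (suc L))) (sym (ℚ.neg-distribʳ-* (fromℕ (suc L)) δ)) ⟩
        fromℕ (suc L) - fromℕ (suc L) * δ
          ≡⟨ cong₂ _-_ (trans (cong fromℕ (ℕ.+-comm 1 L)) (fromℕ-+ L 1)) unit ⟩
        fromℕ L + 1ℚ - 1ℚ                               ≡⟨ ℚ.+-assoc (fromℕ L) 1ℚ (- 1ℚ) ⟩
        fromℕ L + 0ℚ                                    ≡⟨ ℚ.+-identityʳ (fromℕ L) ⟩
        fromℕ L                                         ∎
        where open ≡-Reasoning
      scale : ∀ t → 1ℚ - δ ≤ haltProb t start →
        fromℕ (L ℕ.* 2 ℕ.^ t) ≤ fromℕ (suc L ℕ.* haltCount t start)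
      scale t 1-δ≤ = begin
        fromℕ (L ℕ.* 2 ℕ.^ t)                            ≡⟨ fromℕ-* L (2 ℕ.^ t) ⟩
        fromℕ L * fromℕ (2 ℕ.^ t)                        ≡⟨ cong (_* fromℕ (2 ℕ.^ t)) scaled ⟨
        fromℕ (suc L) * (1ℚ - δ) * fromℕ (2 ℕ.^ t)       ≡⟨ ℚ.*-assoc (fromℕ (suc L)) (1ℚ - δ) _ ⟩
        fromℕ (suc L) * ((1ℚ - δ) * fromℕ (2 ℕ.^ t))
          ≤⟨ ℚ.*-monoˡ-≤-nonNeg (fromℕ (suc L)) {{ℚ.pos⇒nonNeg (fromℕ (suc L)) {{fromℕ-suc-positive L}}}}
               (ℚ.*-monoʳ-≤-nonNeg (fromℕ (2 ℕ.^ t))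
                 {{ℚ.pos⇒nonNeg (fromℕ (2 ℕ.^ t)) {{fromℕ-2^-positive t}}}} 1-δ≤) ⟩
        fromℕ (suc L) * (haltProb t start * fromℕ (2 ℕ.^ t))
          ≡⟨ cong (fromℕ (suc L) *_) (trans (ℚ.*-comm (haltProb t start) (fromℕ (2 ℕ.^ t)))
               (sym (haltCount-haltProb t start))) ⟩
        fromℕ (suc L) * fromℕ (haltCount t start)        ≡⟨ fromℕ-* (suc L) (haltCount t start) ⟨
        fromℕ (suc L ℕ.* haltCount t start)              ∎
        where open ℚ.≤-Reasoning hiding (start)

-- Averaging over uniformly random inputs

module Averaging {n Δ : ℕ} (P : Protocol n Δ) {X Y : Set} (xs : List X) (ys : List Y)
  (GA : X → SimpleGraph n) (GB : Y → SimpleGraph n)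
  (GA∩GB : ∀ x y u v → adj (GA x) u v ∧ adj (GB y) u v ≡ false)
  (maxDeg : ∀ x y → HasMaxDegree (GA x ∪ GB y) Δ)
  (L M : ℕ)
  where
  open import Data.Nat using (_+_; _*_; _≤_; _^_)
  open Rectangles P xs ys GA GB GA∩GB maxDeg

  private
    K = suc L
    ∣X∣ = ∑ xs (λ _ → 1)
    ∣Y∣ = ∑ ys (λ _ → 1)

  root : ∀ {Z : Set} → Strings Z
  root _ = [] ∷ []

  haltsAt bitsAt : ℕ → X → Y → ℕ
  haltsAt t x y = C.haltCount x y t start
  bitsAt  t x y = C.bitCount x y t start

  total-root : ∀ t f → total (within t f []) root root ≡ ∑ xs λ x → ∑ ys λ y → f x y t start
  total-root t f = ∑-cong′ xs λ x → ∑-cong′ ys λ y →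
    trans (ℕ.+-identityʳ (f x y t start + 0)) (ℕ.+-identityʳ (f x y t start))

  ∑∑-const : ∀ c → (∑ xs λ x → ∑ ys λ y → c) ≡ ∣X∣ * (∣Y∣ * c)
  ∑∑-const c = trans (∑-cong′ xs λ _ → ∑-const c ys) (∑-const (∣Y∣ * c) xs)
    where
    ∑-const : ∀ {Z : Set} c (zs : List Z) → ∑ zs (λ _ → c) ≡ ∑ zs (λ _ → 1) * c
    ∑-const c zs = trans (∑-cong′ zs λ _ → sym (ℕ.*-identityˡ c)) (∑-*ʳ c (λ _ → 1) zs)

  module _
    (solves : ∀ x y → R.HaltsAlmostSurely x y × R.AlwaysCorrect x y)
    (silent : ∀ (p : X → Bool) (q : Y → Bool) (cA : X → Coloring n) (cB : Y → Coloring n) →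
      (∀ x y → T (p x) → T (q y) →
        IsProperEdgeColoring (GA x ∪ GB y) (2 * Δ ℕ.∸ 1) (combine (input x y) (cA x) (cB y))) →
      count p xs * count q ys ≤ M)
    (few : 2 ^ suc K * M ≤ ∣X∣ * ∣Y∣) (X≢∅ : 1 ≤ ∣X∣) (Y≢∅ : 1 ≤ ∣Y∣)
    where

    mostly-halting-time : ∃[ t ] All (λ x → All (λ y → MostlyHalts P (input x y) K t) ys) xs
    mostly-halting-time = uniform (λ x t → All (λ y → MostlyHalts P (input x y) K t) ys)
      (λ x t → All.map λ {y} → MostlyHalts-suc P (input x y) K t)
      (λ x → uniform (λ y → MostlyHalts P (input x y) K)
        (λ y → MostlyHalts-suc P (input x y) K)
        (λ y → halts⇒MostlyHalts P (input x y) (proj₁ (solves x y)) K) ys) xs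

    tradeoff-root : ∀ t →
      suc K * halts t [] root root ≤ bits t [] root root + ∣X∣ * (∣Y∣ * 2 ^ t)
    tradeoff-root t = begin
      suc K * halts t [] root root
        ≤⟨ tradeoff M (λ x y → proj₂ (solves x y)) silent t (suc K) [] root root
             (λ _ _ → ℕ.≤-reflexive (trans (ℕ.+-identityʳ (2 ^ t + 0)) (ℕ.+-identityʳ (2 ^ t))))
             (λ _ _ → (ε ∷ []) ∷ []) ⟩
      bits t [] root root + 2 ^ suc K * (2 ^ t * M)
        ≡⟨ cong (bits t [] root root +_) (lemma (2 ^ suc K) (2 ^ t) M) ⟩
      bits t [] root root + 2 ^ suc K * M * 2 ^ t
        ≤⟨ ℕ.+-monoʳ-≤ (bits t [] root root) (ℕ.*-monoˡ-≤ (2 ^ t) few) ⟩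
      bits t [] root root + ∣X∣ * ∣Y∣ * 2 ^ t
        ≡⟨ cong (bits t [] root root +_) (ℕ.*-assoc ∣X∣ ∣Y∣ (2 ^ t)) ⟩
      bits t [] root root + ∣X∣ * (∣Y∣ * 2 ^ t) ∎
      where
      open ℕ.≤-Reasoning
      lemma : ∀ a b c → a * (b * c) ≡ a * c * b
      lemma = solve-∀

    -- The tradeoff is applied with budget `L + 2`. One unit is lost because halting by time `t` has
    -- probability only `K / (K + 1)`, another to the error term, which `few` keeps at most 1; `L`
    -- remains.
    bits-average : ∀ t → All (λ x → All (λ y → MostlyHalts P (input x y) K t) ys) xs →
      ∣X∣ * (∣Y∣ * (L * 2 ^ t)) ≤ ∑ xs λ x → ∑ ys λ y → bitsAt t x y
    bits-average t mostly = ℕ.+-cancelʳ-≤ (∣X∣ * (∣Y∣ * 2 ^ t)) _ _ (begin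
      ∣X∣ * (∣Y∣ * (L * 2 ^ t)) + ∣X∣ * (∣Y∣ * 2 ^ t)
        ≡⟨ lemma ∣X∣ ∣Y∣ L (2 ^ t) ⟩
      ∣X∣ * (∣Y∣ * (K * 2 ^ t))
        ≡⟨ ∑∑-const (K * 2 ^ t) ⟨
      (∑ xs λ x → ∑ ys λ y → K * 2 ^ t)
        ≤⟨ ∑-mono (All.map ∑-mono mostly) ⟩
      (∑ xs λ x → ∑ ys λ y → suc K * haltsAt t x y)
        ≡⟨ trans (∑-cong′ xs λ x → ∑-*ˡ (suc K) (haltsAt t x) ys) (∑-*ˡ (suc K) _ xs) ⟩
      suc K * (∑ xs λ x → ∑ ys λ y → haltsAt t x y)
        ≡⟨ cong (suc K *_) (total-root t C.haltCount) ⟨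
      suc K * halts t [] root root
        ≤⟨ tradeoff-root t ⟩
      bits t [] root root + ∣X∣ * (∣Y∣ * 2 ^ t)
        ≡⟨ cong (_+ ∣X∣ * (∣Y∣ * 2 ^ t)) (total-root t C.bitCount) ⟩
      (∑ xs λ x → ∑ ys λ y → bitsAt t x y) + ∣X∣ * (∣Y∣ * 2 ^ t) ∎)
      where
      open ℕ.≤-Reasoning hiding (start)
      lemma : ∀ a b l c → a * (b * (l * c)) + a * (b * c) ≡ a * (b * (suc l * c))
      lemma = solve-∀

    expensive-pair : ∃[ t ] ∃[ x ] ∃[ y ] L * 2 ^ t ≤ bitsAt t x y
    expensive-pair =
      let (t , mostly) = mostly-halting-time
          (x , le)     = average (∣Y∣ * (L * 2 ^ t)) (λ x → ∑ ys λ y → bitsAt t x y) xs X≢∅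
                           (bits-average t mostly)
          (y , le′)    = average (L * 2 ^ t) (bitsAt t x) ys Y≢∅ le
      in t , x , y , le′

-- The linear lower bound

module _ where
  open import Data.Nat using (_+_; _*_; _≤_; _^_)

  expensive-input : ∀ L r (P : Protocol (suc (suc L) * 2 * 8 + r) 2) →
    (∀ I → Run.HaltsAlmostSurely P I × Run.AlwaysCorrect P I) →
    ∃[ t ] ∃[ x ] ∃[ y ] L * 2 ^ t ≤ Counting.bitCount P (gadgetsInput r x y) t start
  expensive-input L r P solves = Averaging.expensive-pair P (words m) (words m)
    (gadgets gadgetA r) (gadgets gadgetB r) (gadgets-disjoint r) (maxDegree-gadgets r) L (6 ^ m)
    (λ x y → solves (gadgetsInput r x y)) (gadgets-silent r)
    (subst (λ k → 2 ^ suc (suc L) * 6 ^ m ≤ k * k) (sym (∑-words-1 m)) (72^≤81^ (suc (suc L))))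
    nonempty-words nonempty-words
    where
    m = suc (suc L) * 2
    nonempty-words : 1 ≤ ∑ (words m) (λ _ → 1)
    nonempty-words = subst (1 ≤_) (sym (∑-words-1 m)) (ℕ.m^n>0 3 m)

  -- A block of sixteen vertices holds the two gadgets needed per unit of the budget `L + 2`, so `L`
  -- is `n / 16` less 2. From `48 ≤ n` it follows that `1 ≤ L`, and then
  -- `n < 16 * (L + 3) ≤ 64 * L`, the origin of both constants.
  split-48 : ∀ {n} → 48 ≤ n → ∃[ L ] ∃[ r ] suc (suc L) * 2 * 8 + r ≡ n × n ≤ 64 * L
  split-48 {n} 48≤n with n ℕ./ 16 | ℕ./-monoˡ-≤ 16 48≤n | ℕ.m≡m%n+[m/n]*n n 16 | ℕ.m%n<n n 16
  ... | suc (suc (suc k)) | s≤s (s≤s (s≤s z≤n)) | eq | r<16 =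
    suc k , r , trans (lemma₁ k r) (sym eq) , (begin
      n                               ≡⟨ eq ⟩
      r + suc (suc (suc k)) * 16      ≤⟨ ℕ.+-monoˡ-≤ (suc (suc (suc k)) * 16) (ℕ.<⇒≤ r<16) ⟩
      16 + suc (suc (suc k)) * 16     ≡⟨ lemma₂ k ⟩
      64 + 16 * k                     ≤⟨ ℕ.+-monoʳ-≤ 64 (ℕ.*-monoˡ-≤ k (ℕ.m≤n+m 16 48)) ⟩
      64 + 64 * k                     ≡⟨ ℕ.*-suc 64 k ⟨
      64 * suc k                      ∎)
    where
    open ℕ.≤-Reasoning
    r = n ℕ.% 16
    lemma₁ : ∀ k r → suc (suc (suc k)) * 2 * 8 + r ≡ r + suc (suc (suc k)) * 16
    lemma₁ = solve-∀
    lemma₂ : ∀ k → 16 + suc (suc (suc k)) * 16 ≡ 64 + 16 * k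
    lemma₂ = solve-∀

open import Data.Rational using (ℚ; 0ℚ; _*_; _<_)

1/64 : ℚ
1/64 = ℤ.+ 1 ℚ./ 64

fromℕ-≤-expectedBits : ∀ {n Δ} (P : Protocol n Δ) I L t s →
  L ℕ.* 2 ℕ.^ t ℕ.≤ Counting.bitCount P I t s → fromℕ L ℚ.≤ Run.expectedBits P I t s
fromℕ-≤-expectedBits P I L t s le =
  ℚ.*-cancelˡ-≤-pos (fromℕ (2 ℕ.^ t)) {{fromℕ-2^-positive t}} (begin
    fromℕ (2 ℕ.^ t) * fromℕ L                     ≡⟨ ℚ.*-comm (fromℕ (2 ℕ.^ t)) (fromℕ L) ⟩
    fromℕ L * fromℕ (2 ℕ.^ t)                     ≡⟨ fromℕ-* L (2 ℕ.^ t) ⟨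
    fromℕ (L ℕ.* 2 ℕ.^ t)
      ≤⟨ fromℕ-mono-≤ {L ℕ.* 2 ℕ.^ t} {Counting.bitCount P I t s} le ⟩
    fromℕ (Counting.bitCount P I t s)             ≡⟨ bitCount-expectedBits P I t s ⟩
    fromℕ (2 ℕ.^ t) * Run.expectedBits P I t s    ∎)
  where open ℚ.≤-Reasoning

1/64-* : ∀ {n L} → n ℕ.≤ 64 ℕ.* L → 1/64 * fromℕ n ℚ.≤ fromℕ L
1/64-* {n} {L} n≤ = begin
  1/64 * fromℕ n               ≤⟨ ℚ.*-monoˡ-≤-nonNeg 1/64 (fromℕ-mono-≤ {n} {64 ℕ.* L} n≤) ⟩
  1/64 * fromℕ (64 ℕ.* L)      ≡⟨ cong (1/64 *_) (fromℕ-* 64 L) ⟩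
  1/64 * (fromℕ 64 * fromℕ L)  ≡⟨ ℚ.*-assoc 1/64 (fromℕ 64) (fromℕ L) ⟨
  1/64 * fromℕ 64 * fromℕ L    ≡⟨⟩
  ℚ.1ℚ * fromℕ L               ≡⟨ ℚ.*-identityˡ (fromℕ L) ⟩
  fromℕ L                      ∎
  where open ℚ.≤-Reasoning

corollary1p1 : ∃[ c ] ∃[ n₀ ] (0ℚ < c × ((P : ProtocolFamily) → SolvesEdgeColoring P →
    ∀ n → n₀ ℕ.≤ n → ExpectedCommunication≥ P n (c * fromℕ n)))
corollary1p1 = 1/64 , 48 , ℚ.positive⁻¹ 1/64 , λ P solves n 48≤n →
  let (L , r , n≡ , n≤)   = split-48 48≤n
      k                   = suc (suc L) ℕ.* 2 ℕ.* 8 ℕ.+ r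
      (t , x , y , many)  = expensive-input L r (P k 2) (solves k 2)
      I                   = gadgetsInput r x y
      1/64k≤L             = 1/64-* {k} {L} (subst (ℕ._≤ 64 ℕ.* L) (sym n≡) n≤)
  in subst (λ n → ExpectedCommunication≥ P n (1/64 * fromℕ n)) n≡
       -- The truncated expectation at the one time `t` already reaches the bound, so `t` serves for
       -- every `q` below it.
       (2 , I , λ q q< → t , ℚ.<-≤-trans q< (ℚ.≤-trans 1/64k≤L
         (fromℕ-≤-expectedBits (P k 2) I L t start many)))
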